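{- Let $d,k,l\ge1$ be integers and let $S\subset\mathbb R^d$ be a lattice simplex with $|I_l(S)|=k$. Then $$\mathrm{vol}(S)\le \frac{2^{3d-2}\cdot l^d\cdot(8l+7)^{(d-1)2^{d+1}}\cdot k}{d!}.$$ Equivalently, $s(d,k,l)\le 2^{3d-2} l^d (8l+7)^{(d-1)2^{d+1}}k/d!$.
   Context: A lattice simplex is a $d$-dimensional simplex whose vertices lie in $\mathbb Z^d$. $I_l(S)=\mathrm{int}(S)\cap l\mathbb Z^d$ is the set of interior points of $S$ whose coordinates are integers divisible by $l$. $s(d,k,l)$ denotes the maximum volume of a lattice simplex $S\subset\mathbb R^d$ with $|I_l(S)|=k$. -}

module Defs where

open import Data.Nat as ℕ using (ℕ; zero; suc)
open import Data.Integer as ℤ using (ℤ; +_; -_; ∣_∣)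
open import Data.Integer.Divisibility using () renaming (_∣_ to _∣ℤ_)
open import Data.Fin using (Fin; toℕ) renaming (zero to fzero; suc to fsuc)
open import Data.Vec using (Vec; []; _∷_; map; zipWith; replicate; foldr; removeAt; tabulate; lookup)
open import Data.Vec.Relation.Unary.All using (All)
open import Data.List using (List; length)
open import Data.List.Relation.Unary.Unique.Propositional using (Unique)
open import Data.List.Membership.Propositional using (_∈_)
open import Data.Product using (Σ; _×_)
open import Relation.Binary.PropositionalEquality using (_≡_)
open import Function.Bundles using (_⇔_)
open import Data.Empty using (⊥)

Point : ℕ → Set
Point d = Vec ℤ d

sumFin : ∀ {n} → (Fin n → ℤ) → ℤ
sumFin {zero}  f = + 0
sumFin {suc n} f = f fzero ℤ.+ sumFin (λ i → f (fsuc i))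

sign : ℕ → ℤ
sign zero          = + 1
sign (suc zero)    = - (+ 1)
sign (suc (suc n)) = sign n

det : ∀ {n} → Vec (Vec ℤ n) n → ℤ
det {zero}  []       = + 1
det {suc n} (r ∷ rs) =
  sumFin (λ j → sign (toℕ j) ℤ.* lookup r j ℤ.* det (map (λ row → removeAt row j) rs))

_-ᵥ_ : ∀ {d} → Point d → Point d → Point d
_-ᵥ_ = zipWith ℤ._-_

_+ᵥ_ : ∀ {d} → Point d → Point d → Point d
_+ᵥ_ = zipWith ℤ._+_

_·ᵥ_ : ∀ {d} → ℕ → Point d → Point d
m ·ᵥ x = map (λ c → + m ℤ.* c) x

vsum : ∀ {d n} → Vec (Point d) n → Point d
vsum = foldr _ _+ᵥ_ (replicate _ (+ 0))

Vertices : ℕ → Set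
Vertices d = Vec (Point d) (suc d)

edgeMatrix : ∀ {d} → Vertices d → Vec (Vec ℤ d) d
edgeMatrix (v₀ ∷ vs) = map (λ v → v -ᵥ v₀) vs

-- d! · vol(S) = |det(v₁ - v₀, …, v_d - v₀)|  (normalized volume, a natural number)
normVol : ∀ {d} → Vertices d → ℕ
normVol v = ∣ det (edgeMatrix v) ∣

IsSimplex : ∀ {d} → Vertices d → Set
IsSimplex v = normVol v ≡ 0 → ⊥

-- x lies in the interior of conv(v₀,…,v_d): x = Σ λᵢ vᵢ with all λᵢ > 0
-- rational and Σ λᵢ = 1.  Clearing denominators: there are positive
-- integers μᵢ with (Σ μᵢ)·x = Σ μᵢ vᵢ  (λᵢ = μᵢ / Σ μ).
InInterior : ∀ {d} → Vertices d → Point d → Set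
InInterior {d} v x =
  Σ (Vec ℕ (suc d)) λ μ →
    All (λ m → 1 ℕ.≤ m) μ × (Data.Vec.sum μ ·ᵥ x ≡ vsum (zipWith _·ᵥ_ μ v))

InLattice : ∀ {d} → ℕ → Point d → Set
InLattice l x = All (λ c → (+ l) ∣ℤ c) x

Il : ∀ {d} → ℕ → Vertices d → Point d → Set
Il l v x = InInterior v x × InLattice l x

HasCard : ∀ {d} → (Point d → Set) → ℕ → Set
HasCard {d} P k =
  Σ (List (Point d)) λ L → Unique L × (length L ≡ k) × (∀ x → (x ∈ L) ⇔ P x)

{-# OPTIONS --safe #-}

-- Write an interior point w of lℤᵈ in barycentric coordinates aᵢ/N, sorted decreasingly. If some aⱼ is
-- tiny compared with the product of the earlier ones, Dirichlet's principle gives q ≥ 1 for which each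
-- q·aᵢ/N with i < j is close to an integer xᵢ, and (1 + lq)w - l·Σ xᵢvᵢ is an interior point of lℤᵈ with
-- a larger least coordinate: the coordinates from j on at least double, the others hardly change.
-- So some w has no such gap, and its coordinates satisfy a recursive lower bound of doubly exponential
-- type. By Blichfeldt's argument the box with sides aᵢ/N, i ≥ 1, around w then yields at least
-- |det|·∏aᵢ / (l·d·N)ᵈ interior points of lℤᵈ. That a box holds as many lattice points as its volume
-- is seen by reducing the edge matrix to triangular form with integral column operations.
module Submission where

open import Defs
open import Data.Nat as ℕ using (ℕ; zero; suc; _*_; _^_; _+_; _∸_; _≤_)
import Data.Nat.DivMod as ℕD
open import Data.Nat.Induction using (Acc; acc; <-wellFounded)
import Data.Nat.Properties as ℕP
import Data.Nat.Tactic.RingSolver as ℕSolver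
open import Data.Integer as ℤ using (ℤ; +_; -_; ∣_∣)
import Data.Integer.Divisibility.Signed as ℤS
import Data.Integer.DivMod as ℤD
import Data.Integer.Properties as ℤP
open import Data.Integer.Tactic.RingSolver using (solve-∀)
open import Data.Fin as Fin using (Fin; zero; suc; toℕ; fromℕ<; punchOut; remQuot; combine; funToFin; finToFun)
import Data.Fin.Properties as FinP
open import Data.List as List using (List; []; _∷_)
open import Data.List.Membership.Propositional using (_∈_)
import Data.List.Relation.Unary.Any as Any
import Data.List.Relation.Unary.Any.Properties as AnyP
open import Data.Vec as Vec using (Vec; []; _∷_; map; replicate; removeAt; lookup; zipWith; sum; tabulate)
open import Data.Vec.Properties using
  (map-cong; map-∘; map-id; lookup-replicate; lookup-map; lookup-zipWith; lookup∘tabulate;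
   tabulate∘lookup; tabulate-cong; ∷-injective; map-proj₁-zip; map-proj₂-zip)
open import Data.Vec.Relation.Unary.All as All using (All; []; _∷_)
import Data.Vec.Relation.Unary.All.Properties as AllP
open import Data.Vec.Relation.Unary.AllPairs using (AllPairs; []; _∷_)
import Data.Vec.Relation.Unary.AllPairs.Properties as AllPairsP
open import Data.Product using (Σ; ∃; ∃₂; _×_; _,_; proj₁; proj₂)
open import Data.Sum using (_⊎_; inj₁; inj₂)
open import Data.Empty using (⊥-elim)
open import Function using (_∘_)
open import Function.Bundles using (mk⇔; Equivalence)
open import Relation.Nullary using (yes; no)
open import Relation.Binary.Construct.Closure.ReflexiveTransitive using (Star; ε; _◅_; _◅◅_; gmap)
open import Relation.Binary.Definitions using (Total; Transitive)
open import Relation.Binary.PropositionalEquality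

-- Determinants under column and row operations

-- All fractions are cleared: a point is a vector of natural weights with total N. The largest
-- weight is placed at the base vertex of the edge matrix, and it alone compensates for the motion
-- of the other d weights, both when w is improved (hence K = 4dl) and in the box argument (hence
-- the factor d^d). The double exponent arises when no gap occurs: each further weight is bounded
-- through the number of colours spent on the earlier ones, which squares the constant reached so
-- far. The determinant is given by expansion along the first row only, so its invariance starts
-- from additions between adjacent columns, which can be followed through the deletion of a column;
-- row operations come afterwards, by reducing a row to a single entry. The uniform estimate of the
-- constants reaches the exponent (d-1)·2^(d+1) only from d = 3 on: the plane needs the exact value
-- of the loss, and in dimension one, where this exponent is 0, multiples of l are counted directly.

Mat : ℕ → Set
Mat n = Vec (Vec ℤ n) n

-- The sign is a parameter that flips at each term, so inductions over the columns never meet the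
-- parity of an index.
altSum : ∀ {n} → ℤ → (Fin n → ℤ) → ℤ
altSum {zero}  s t = + 0
altSum {suc n} s t = s ℤ.* t zero ℤ.+ altSum (- s) (t ∘ suc)

altSum-cong : ∀ {n} s {t u : Fin n → ℤ} → (∀ j → t j ≡ u j) → altSum s t ≡ altSum s u
altSum-cong {zero}  s eq = refl
altSum-cong {suc n} s eq = cong₂ (λ x y → s ℤ.* x ℤ.+ y) (eq zero) (altSum-cong (- s) (eq ∘ suc))

altSum-zero : ∀ {n} s {t : Fin n → ℤ} → (∀ j → t j ≡ + 0) → altSum s t ≡ + 0
altSum-zero {zero}  s eq = refl
altSum-zero {suc n} s eq =
  trans (cong₂ (λ x y → s ℤ.* x ℤ.+ y) (eq zero) (altSum-zero (- s) (eq ∘ suc))) (e s)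
  where
  e : ∀ s → s ℤ.* + 0 ℤ.+ + 0 ≡ + 0
  e = solve-∀

altSum-lin : ∀ {n} s m {t u v : Fin n → ℤ} → (∀ j → t j ≡ u j ℤ.+ m ℤ.* v j) →
  altSum s t ≡ altSum s u ℤ.+ m ℤ.* altSum s v
altSum-lin {zero}  s m eq = e m
  where
  e : ∀ m → + 0 ≡ + 0 ℤ.+ m ℤ.* + 0
  e = solve-∀
altSum-lin {suc n} s m {t} {u} {v} eq =
  trans (cong₂ (λ x y → s ℤ.* x ℤ.+ y) (eq zero) (altSum-lin (- s) m (eq ∘ suc)))
        (e s m (u zero) (v zero) _ _)
  where
  e : ∀ s m a b x y → s ℤ.* (a ℤ.+ m ℤ.* b) ℤ.+ (x ℤ.+ m ℤ.* y) ≡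
    (s ℤ.* a ℤ.+ x) ℤ.+ m ℤ.* (s ℤ.* b ℤ.+ y)
  e = solve-∀

sign-suc : ∀ k → sign (suc k) ≡ - sign k
sign-suc zero = refl
sign-suc (suc zero) = refl
sign-suc (suc (suc k)) = sign-suc k

minor : ∀ {n} → Vec (Vec ℤ (suc n)) n → Fin (suc n) → ℤ
minor rs j = det (map (λ row → removeAt row j) rs)

-- The offset `k` carries the induction: dropping the first term shifts all positions by one.
sumFin-altSum : ∀ {n} k (r g : Fin n → ℤ) →
  sumFin (λ j → sign (k + toℕ j) ℤ.* r j ℤ.* g j) ≡ altSum (sign k) (λ j → r j ℤ.* g j)
sumFin-altSum {zero}  k r g = refl
sumFin-altSum {suc n} k r g = cong₂ ℤ._+_ here rest
  where
  here : sign (k + 0) ℤ.* r zero ℤ.* g zero ≡ sign k ℤ.* (r zero ℤ.* g zero)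
  here rewrite ℕP.+-identityʳ k = ℤP.*-assoc (sign k) (r zero) (g zero)
  sumFin-cong : ∀ {n} {f h : Fin n → ℤ} → (∀ j → f j ≡ h j) → sumFin f ≡ sumFin h
  sumFin-cong {zero} eq = refl
  sumFin-cong {suc n} eq = cong₂ ℤ._+_ (eq zero) (sumFin-cong (eq ∘ suc))
  rest : sumFin (λ j → sign (k + suc (toℕ j)) ℤ.* r (suc j) ℤ.* g (suc j)) ≡
    altSum (- sign k) (λ j → r (suc j) ℤ.* g (suc j))
  rest = trans (sumFin-cong (λ j → cong (λ i → sign i ℤ.* r (suc j) ℤ.* g (suc j)) (ℕP.+-suc k (toℕ j))))
    (trans (sumFin-altSum (suc k) (r ∘ suc) (g ∘ suc)) (cong (λ s → altSum s (λ j → r (suc j) ℤ.* g (suc j))) (sign-suc k)))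

det-laplace : ∀ {n} (r : Vec ℤ (suc n)) rs →
  det (r ∷ rs) ≡ altSum (+ 1) (λ j → lookup r j ℤ.* minor rs j)
det-laplace r rs = sumFin-altSum 0 (lookup r) (minor rs)

data LinAt (m : ℤ) : ∀ {n} → Fin n → (a b c : Vec ℤ n) → Set where
  here  : ∀ {n x y} {r : Vec ℤ n} → LinAt m zero (x ℤ.+ m ℤ.* y ∷ r) (x ∷ r) (y ∷ r)
  there : ∀ {n x p} {a b c : Vec ℤ n} → LinAt m p a b c → LinAt m (suc p) (x ∷ a) (x ∷ b) (x ∷ c)

linAt-lookup : ∀ {m n p} {a b c : Vec ℤ n} → LinAt m p a b c →
  lookup a p ≡ lookup b p ℤ.+ m ℤ.* lookup c p
linAt-lookup here = refl
linAt-lookup (there h) = linAt-lookup h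

linAt-lookup-≢ : ∀ {m n p} {a b c : Vec ℤ n} → LinAt m p a b c → ∀ j → j ≢ p →
  lookup a j ≡ lookup b j × lookup c j ≡ lookup b j
linAt-lookup-≢ here zero j≢p = ⊥-elim (j≢p refl)
linAt-lookup-≢ here (suc j) j≢p = refl , refl
linAt-lookup-≢ (there h) zero j≢p = refl , refl
linAt-lookup-≢ (there h) (suc j) j≢p = linAt-lookup-≢ h j (j≢p ∘ cong suc)

linAt-removeAt : ∀ {m n p} {a b c : Vec ℤ (suc n)} → LinAt m p a b c →
  removeAt a p ≡ removeAt b p × removeAt c p ≡ removeAt b p
linAt-removeAt here = refl , refl
linAt-removeAt {n = suc n} (there {x = x} h@here) = cong (x ∷_) (proj₁ (linAt-removeAt h)) , cong (x ∷_) (proj₂ (linAt-removeAt h))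
linAt-removeAt {n = suc n} (there {x = x} h@(there _)) = cong (x ∷_) (proj₁ (linAt-removeAt h)) , cong (x ∷_) (proj₂ (linAt-removeAt h))

linAt-removeAt-≢ : ∀ {m n p} {a b c : Vec ℤ (suc n)} → LinAt m p a b c → ∀ {j} (j≢p : j ≢ p) →
  LinAt m (punchOut j≢p) (removeAt a j) (removeAt b j) (removeAt c j)
linAt-removeAt-≢ here {zero} j≢p = ⊥-elim (j≢p refl)
linAt-removeAt-≢ {n = suc n} (here {r = _ ∷ _}) {suc j} j≢p = here
linAt-removeAt-≢ (there h) {zero} j≢p = h
linAt-removeAt-≢ {n = suc n} (there h@here) {suc j} j≢p = there (linAt-removeAt-≢ h (j≢p ∘ cong suc))
linAt-removeAt-≢ {n = suc n} (there h@(there _)) {suc j} j≢p = there (linAt-removeAt-≢ h (j≢p ∘ cong suc))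

minor-map : ∀ {n} {T : Set} (f : T → Vec ℤ (suc n)) (ts : Vec T n) j →
  minor (map f ts) j ≡ det (map (λ t → removeAt (f t) j) ts)
minor-map f ts j = cong det (sym (map-∘ _ f ts))

-- In the expansion, column p has a linear entry and a common minor; any other column has a common
-- entry and minors that are linear by induction. The three matrices are images of one vector `ts`
-- because deleting a column is again a map over `ts`.
det-lin : ∀ {n m} (p : Fin n) {T : Set} {fa fb fc : T → Vec ℤ n} →
  (∀ t → LinAt m p (fa t) (fb t) (fc t)) → (ts : Vec T n) →
  det (map fa ts) ≡ det (map fb ts) ℤ.+ m ℤ.* det (map fc ts)
det-lin {suc n} {m} p {fa = fa} {fb} {fc} lin (t ∷ ts) = begin
  det (map fa (t ∷ ts))                                    ≡⟨ det-laplace (fa t) _ ⟩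
  altSum (+ 1) (λ j → lookup (fa t) j ℤ.* minor (map fa ts) j)
    ≡⟨ altSum-lin (+ 1) m {u = λ j → lookup (fb t) j ℤ.* minor (map fb ts) j} {λ j → lookup (fc t) j ℤ.* minor (map fc ts) j} term ⟩
  altSum (+ 1) (λ j → lookup (fb t) j ℤ.* minor (map fb ts) j) ℤ.+
    m ℤ.* altSum (+ 1) (λ j → lookup (fc t) j ℤ.* minor (map fc ts) j)
    ≡⟨ cong₂ (λ x y → x ℤ.+ m ℤ.* y) (det-laplace (fb t) _) (det-laplace (fc t) _) ⟨
  det (map fb (t ∷ ts)) ℤ.+ m ℤ.* det (map fc (t ∷ ts)) ∎
  where
  open ≡-Reasoning
  e₁ : ∀ x y m g → (x ℤ.+ m ℤ.* y) ℤ.* g ≡ x ℤ.* g ℤ.+ m ℤ.* (y ℤ.* g)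
  e₁ = solve-∀
  e₂ : ∀ x m g h → x ℤ.* (g ℤ.+ m ℤ.* h) ≡ x ℤ.* g ℤ.+ m ℤ.* (x ℤ.* h)
  e₂ = solve-∀
  term : ∀ j → lookup (fa t) j ℤ.* minor (map fa ts) j ≡
    lookup (fb t) j ℤ.* minor (map fb ts) j ℤ.+ m ℤ.* (lookup (fc t) j ℤ.* minor (map fc ts) j)
  term j with j Fin.≟ p
  ... | yes refl
    rewrite minor-map fa ts j | minor-map fb ts j | minor-map fc ts j
          | map-cong (λ t → proj₁ (linAt-removeAt (lin t))) ts
          | map-cong (λ t → proj₂ (linAt-removeAt (lin t))) ts
          | linAt-lookup (lin t) = e₁ (lookup (fb t) j) _ m _
  ... | no j≢p
    rewrite minor-map fa ts j | minor-map fb ts j | minor-map fc ts j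
          | proj₁ (linAt-lookup-≢ (lin t) j j≢p) | proj₂ (linAt-lookup-≢ (lin t) j j≢p)
          | det-lin (punchOut j≢p) (λ t → linAt-removeAt-≢ (lin t) j≢p) ts
          = e₂ (lookup (fb t) j) m _ _

-- The number of skips is the position of the two adjacent columns.
data ColOp : ℕ → Set where
  addL addR : ∀ {n} → ℤ → ColOp (suc (suc n))
  skip      : ∀ {n} → ColOp n → ColOp (suc n)

act : ∀ {n} → ColOp n → Vec ℤ n → Vec ℤ n
act (addL m) (x ∷ y ∷ r) = x ℤ.+ m ℤ.* y ∷ y ∷ r
act (addR m) (x ∷ y ∷ r) = x ∷ y ℤ.+ m ℤ.* x ∷ r
act (skip o) (x ∷ r)     = x ∷ act o r

src tgt : ∀ {n} → ColOp n → Fin n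
src (addL m) = suc zero
src (addR m) = zero
src (skip o) = suc (src o)
tgt (addL m) = zero
tgt (addR m) = suc zero
tgt (skip o) = suc (tgt o)

coeff : ∀ {n} → ColOp n → ℤ
coeff (addL m) = m
coeff (addR m) = m
coeff (skip o) = coeff o

lookup-act-tgt : ∀ {n} (o : ColOp n) r →
  lookup (act o r) (tgt o) ≡ lookup r (tgt o) ℤ.+ coeff o ℤ.* lookup r (src o)
lookup-act-tgt (addL m) (x ∷ y ∷ r) = refl
lookup-act-tgt (addR m) (x ∷ y ∷ r) = refl
lookup-act-tgt (skip o) (x ∷ r) = lookup-act-tgt o r

lookup-act : ∀ {n} (o : ColOp n) r j → j ≢ tgt o → lookup (act o r) j ≡ lookup r j
lookup-act (addL m) (x ∷ y ∷ r) zero j≢ = ⊥-elim (j≢ refl)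
lookup-act (addL m) (x ∷ y ∷ r) (suc j) j≢ = refl
lookup-act (addR m) (x ∷ y ∷ r) zero j≢ = refl
lookup-act (addR m) (x ∷ y ∷ r) (suc zero) j≢ = ⊥-elim (j≢ refl)
lookup-act (addR m) (x ∷ y ∷ r) (suc (suc j)) j≢ = refl
lookup-act (skip o) (x ∷ r) zero j≢ = refl
lookup-act (skip o) (x ∷ r) (suc j) j≢ = lookup-act o r j (j≢ ∘ cong suc)

src≢tgt : ∀ {n} (o : ColOp n) → src o ≢ tgt o
src≢tgt (addL m) ()
src≢tgt (addR m) ()
src≢tgt (skip o) eq = src≢tgt o (FinP.suc-injective eq)

removeAt-act-tgt : ∀ {n} (o : ColOp (suc n)) r → removeAt (act o r) (tgt o) ≡ removeAt r (tgt o)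
removeAt-act-tgt (addL m) (x ∷ y ∷ r) = refl
removeAt-act-tgt (addR m) (x ∷ y ∷ r) = refl
removeAt-act-tgt {suc n} (skip o@(addL _)) (x ∷ r@(_ ∷ _ ∷ _)) = cong (x ∷_) (removeAt-act-tgt o r)
removeAt-act-tgt {suc n} (skip o@(addR _)) (x ∷ r@(_ ∷ _ ∷ _)) = cong (x ∷_) (removeAt-act-tgt o r)
removeAt-act-tgt {suc n} (skip o@(skip _)) (x ∷ r@(_ ∷ _)) = cong (x ∷_) (removeAt-act-tgt o r)

-- Source and target are adjacent, so deleting either one moves the other to the same place.
removeAt-act-src : ∀ {n} (o : ColOp (suc n)) → ∃ λ p → ∀ r →
  LinAt (coeff o) p (removeAt (act o r) (src o)) (removeAt r (src o)) (removeAt r (tgt o))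
removeAt-act-src (addL m) = zero , λ { (x ∷ y ∷ r) → here }
removeAt-act-src (addR m) = zero , λ { (x ∷ y ∷ r) → here }
removeAt-act-src {suc n} (skip o) with removeAt-act-src o
... | p , h = suc p , λ { (x ∷ r@(_ ∷ _)) → go x r (h r) }
  where
  cons : ∀ {n} x (r : Vec ℤ (suc n)) i → removeAt (x ∷ r) (suc i) ≡ x ∷ removeAt r i
  cons x (_ ∷ _) i = refl
  go : ∀ x r → LinAt (coeff o) p (removeAt (act o r) (src o)) (removeAt r (src o)) (removeAt r (tgt o)) →
    LinAt (coeff o) (suc p) (removeAt (x ∷ act o r) (suc (src o))) (removeAt (x ∷ r) (suc (src o))) (removeAt (x ∷ r) (suc (tgt o)))
  go x r h rewrite cons x (act o r) (src o) | cons x r (src o) | cons x r (tgt o) = there h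

-- A third column never stands between the two adjacent ones, so its deletion leaves an operation of
-- the same kind.
removeAt-act : ∀ {n} (o : ColOp (suc n)) j → j ≢ src o → j ≢ tgt o →
  ∃ λ (o′ : ColOp n) → ∀ r → removeAt (act o r) j ≡ act o′ (removeAt r j)
removeAt-act (addL m) zero _ j≢ = ⊥-elim (j≢ refl)
removeAt-act (addL m) (suc zero) j≢ _ = ⊥-elim (j≢ refl)
removeAt-act {suc (suc n)} (addL m) (suc (suc j)) _ _ = addL m , λ { (x ∷ y ∷ z ∷ r) → refl }
removeAt-act (addR m) zero j≢ _ = ⊥-elim (j≢ refl)
removeAt-act (addR m) (suc zero) _ j≢ = ⊥-elim (j≢ refl)
removeAt-act {suc (suc n)} (addR m) (suc (suc j)) _ _ = addR m , λ { (x ∷ y ∷ z ∷ r) → refl }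
removeAt-act (skip o) zero _ _ = o , λ { (x ∷ r) → refl }
removeAt-act {suc n} (skip o) (suc j) j≢s j≢t with removeAt-act o j (j≢s ∘ cong suc) (j≢t ∘ cong suc)
... | o′ , h = skip o′ , λ { (x ∷ r@(_ ∷ _)) → trans (cons x (act o r) j) (cong (x ∷_) (h r)) }
  where
  cons : ∀ {n} x (r : Vec ℤ (suc n)) i → removeAt (x ∷ r) (suc i) ≡ x ∷ removeAt r i
  cons x (_ ∷ _) i = refl

-- Adjacent positions carry opposite signs, so the sum sees these two terms only through their
-- difference.
altSum-adjacent : ∀ {n} (o : ColOp n) s {t u : Fin n → ℤ} →
  (∀ j → j ≢ src o → j ≢ tgt o → t j ≡ u j) →
  t (tgt o) ℤ.- t (src o) ≡ u (tgt o) ℤ.- u (src o) → altSum s t ≡ altSum s u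
altSum-adjacent (addL m) s {t} {u} eq diff =
  trans (e s _ _ _) (trans (cong₂ (λ x y → s ℤ.* x ℤ.+ y) diff
    (altSum-cong (- - s) λ j → eq (suc (suc j)) (λ ()) (λ ()))) (sym (e s _ _ _)))
  where
  e : ∀ s x y z → s ℤ.* x ℤ.+ (- s ℤ.* y ℤ.+ z) ≡ s ℤ.* (x ℤ.- y) ℤ.+ z
  e = solve-∀
altSum-adjacent (addR m) s {t} {u} eq diff =
  trans (e s _ _ _) (trans (cong₂ (λ x y → - s ℤ.* x ℤ.+ y) diff
    (altSum-cong (- - s) λ j → eq (suc (suc j)) (λ ()) (λ ()))) (sym (e s _ _ _)))
  where
  e : ∀ s x y z → s ℤ.* x ℤ.+ (- s ℤ.* y ℤ.+ z) ≡ - s ℤ.* (y ℤ.- x) ℤ.+ z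
  e = solve-∀
altSum-adjacent (skip o) s eq diff = cong₂ (λ x y → s ℤ.* x ℤ.+ y) (eq zero (λ ()) (λ ()))
  (altSum-adjacent o (- s) (λ j j≢s j≢t → eq (suc j)
    (j≢s ∘ FinP.suc-injective) (j≢t ∘ FinP.suc-injective)) diff)

-- The entry at the target gains m times the source entry, and the minor at the source gains m times
-- the target minor. In the difference of the two terms these gains cancel.
det-act : ∀ {n} (o : ColOp n) (E : Mat n) → det (map (act o) E) ≡ det E
det-act {suc n} o (r ∷ rs) = trans (det-laplace (act o r) _)
  (trans (altSum-adjacent o (+ 1) other adj) (sym (det-laplace r rs)))
  where
  at-tgt : minor (map (act o) rs) (tgt o) ≡ minor rs (tgt o)
  at-tgt = trans (minor-map (act o) rs (tgt o)) (cong det (map-cong (removeAt-act-tgt o) rs))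
  at-src : minor (map (act o) rs) (src o) ≡ minor rs (src o) ℤ.+ coeff o ℤ.* minor rs (tgt o)
  at-src = trans (minor-map (act o) rs (src o))
    (det-lin (proj₁ (removeAt-act-src o)) (proj₂ (removeAt-act-src o)) rs)
  other : ∀ j → j ≢ src o → j ≢ tgt o →
    lookup (act o r) j ℤ.* minor (map (act o) rs) j ≡ lookup r j ℤ.* minor rs j
  other j j≢s j≢t with removeAt-act o j j≢s j≢t
  ... | o′ , h = cong₂ ℤ._*_ (lookup-act o r j j≢t) (trans (minor-map (act o) rs j)
    (trans (cong det (trans (map-cong h rs) (map-∘ (act o′) _ rs))) (det-act o′ _)))
  e : ∀ a m b g h → (a ℤ.+ m ℤ.* b) ℤ.* g ℤ.- b ℤ.* (h ℤ.+ m ℤ.* g) ≡ a ℤ.* g ℤ.- b ℤ.* h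
  e = solve-∀
  adj : lookup (act o r) (tgt o) ℤ.* minor (map (act o) rs) (tgt o) ℤ.-
        lookup (act o r) (src o) ℤ.* minor (map (act o) rs) (src o) ≡
        lookup r (tgt o) ℤ.* minor rs (tgt o) ℤ.- lookup r (src o) ℤ.* minor rs (src o)
  adj rewrite at-tgt | at-src | lookup-act-tgt o r | lookup-act o r (src o) (src≢tgt o) =
    e (lookup r (tgt o)) (coeff o) (lookup r (src o)) _ _

acts : ∀ {n} → List (ColOp n) → Vec ℤ n → Vec ℤ n
acts []       r = r
acts (o ∷ os) r = acts os (act o r)

acts-++ : ∀ {n} (os ps : List (ColOp n)) r → acts (os List.++ ps) r ≡ acts ps (acts os r)
acts-++ []       ps r = refl
acts-++ (o ∷ os) ps r = acts-++ os ps (act o r)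

acts-skip : ∀ {n} (os : List (ColOp n)) x r → acts (List.map skip os) (x ∷ r) ≡ x ∷ acts os r
acts-skip []       x r = refl
acts-skip (o ∷ os) x r = acts-skip os x (act o r)

det-acts : ∀ {n} (os : List (ColOp n)) (E : Mat n) → det (map (acts os) E) ≡ det E
det-acts []       E = cong det (map-id E)
det-acts (o ∷ os) E = trans (cong det (map-∘ (acts os) (act o) E))
  (trans (det-acts os _) (det-act o E))

-- Euclidean reduction of a row, and row operations derived from it

remainder : ∀ a b → b ≢ + 0 → ∃₂ λ m r → a ℤ.+ m ℤ.* b ≡ + r × r ℕ.< ∣ b ∣
remainder a b b≢0 = - (a ℤD./ b) , a ℤD.% b ,
  trans (cong (ℤ._+ - (a ℤD./ b) ℤ.* b) (ℤD.a≡a%n+[a/n]*n a b)) (e _ (a ℤD./ b) b) , ℤD.n%d<d a b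
  where
  instance _ = ℤ.≢-nonZero b≢0
  e : ∀ r q b → r ℤ.+ q ℤ.* b ℤ.+ - q ℤ.* b ≡ r
  e = solve-∀

euclid : ∀ {n} a b (t : Vec ℤ n) → Acc ℕ._<_ ∣ b ∣ →
  ∃₂ λ os g → acts os (a ∷ b ∷ t) ≡ g ∷ + 0 ∷ t
euclid a b t (acc rec) with b ℤ.≟ + 0
... | yes refl = [] , a , refl
... | no b≢0 with remainder a b b≢0
-- The pair is now (0, b). No swap is among the operations, so two additions lead through (b, b) to
-- (b, 0).
...   | m , zero , eq , _ = addL m ∷ addL (+ 1) ∷ addR (- + 1) ∷ [] , _ ,
        cong (λ z → a ℤ.+ m ℤ.* b ℤ.+ + 1 ℤ.* b ∷ z ∷ t) (trans (cong (λ z → b ℤ.+ - + 1 ℤ.* (z ℤ.+ + 1 ℤ.* b)) eq) (e b))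
  where
  e : ∀ b → b ℤ.+ - + 1 ℤ.* (+ 0 ℤ.+ + 1 ℤ.* b) ≡ + 0
  e = solve-∀
-- Two divisions per call return the pair in the order larger, smaller, again without a swap.
...   | m , suc r , eq , r<b with remainder b (+ suc r) (λ ())
...     | m′ , r′ , eq′ , r′<r with euclid (+ suc r) (+ r′) t (rec (ℕP.<-trans r′<r r<b))
...       | os , g , eq″ = addL m ∷ addR m′ ∷ os , g ,
            trans (cong (acts os) (cong₂ (λ x y → x ∷ y ∷ t) eq (trans (cong (λ z → b ℤ.+ m′ ℤ.* z) eq) eq′))) eq″

reduce : ∀ {n} (r : Vec ℤ (suc n)) → ∃₂ λ os h → acts os r ≡ h ∷ replicate n (+ 0)
reduce (h ∷ []) = [] , h , refl
reduce (x ∷ r@(_ ∷ _)) with reduce r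
... | os , h , eq with euclid x h (replicate _ (+ 0)) (<-wellFounded ∣ h ∣)
...   | ps , g , eq′ = List.map skip os List.++ ps , g ,
        trans (acts-++ (List.map skip os) ps (x ∷ r)) (trans (cong (acts ps)
          (trans (acts-skip os x r) (cong (x ∷_) eq))) eq′)

addMul : ∀ {n} → ℤ → Vec ℤ n → Vec ℤ n → Vec ℤ n
addMul m []       []       = []
addMul m (x ∷ xs) (y ∷ ys) = x ℤ.+ m ℤ.* y ∷ addMul m xs ys

lookup-addMul : ∀ {n} m (x y : Vec ℤ n) j → lookup (addMul m x y) j ≡ lookup x j ℤ.+ m ℤ.* lookup y j
lookup-addMul m (x ∷ xs) (y ∷ ys) zero = refl
lookup-addMul m (x ∷ xs) (y ∷ ys) (suc j) = lookup-addMul m xs ys j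

addMul-zeroʳ : ∀ {n} m (x : Vec ℤ n) → addMul m x (replicate n (+ 0)) ≡ x
addMul-zeroʳ m [] = refl
addMul-zeroʳ m (x ∷ xs) = cong₂ _∷_ (trans (cong (λ z → x ℤ.+ z) (ℤP.*-zeroʳ m)) (ℤP.+-identityʳ x)) (addMul-zeroʳ m xs)

removeAt-addMul : ∀ {n} m (x y : Vec ℤ (suc n)) j →
  removeAt (addMul m x y) j ≡ addMul m (removeAt x j) (removeAt y j)
removeAt-addMul m (x ∷ xs) (y ∷ ys) zero = refl
removeAt-addMul m (x ∷ xs@(_ ∷ _)) (y ∷ ys@(_ ∷ _)) (suc j) = cong (_ ∷_) (removeAt-addMul m xs ys j)

act-addMul : ∀ {n} (o : ColOp n) m x y → act o (addMul m x y) ≡ addMul m (act o x) (act o y)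
act-addMul (addL k) m (x ∷ y ∷ r) (z ∷ w ∷ s) = cong (_∷ _) (e k m x y z w)
  where
  e : ∀ k m x y z w → x ℤ.+ m ℤ.* z ℤ.+ k ℤ.* (y ℤ.+ m ℤ.* w) ≡ x ℤ.+ k ℤ.* y ℤ.+ m ℤ.* (z ℤ.+ k ℤ.* w)
  e = solve-∀
act-addMul (addR k) m (x ∷ y ∷ r) (z ∷ w ∷ s) = cong (λ u → _ ∷ u ∷ _) (e k m y x w z)
  where
  e : ∀ k m x y z w → x ℤ.+ m ℤ.* z ℤ.+ k ℤ.* (y ℤ.+ m ℤ.* w) ≡ x ℤ.+ k ℤ.* y ℤ.+ m ℤ.* (z ℤ.+ k ℤ.* w)
  e = solve-∀
act-addMul (skip o) m (x ∷ xs) (y ∷ ys) = cong (_ ∷_) (act-addMul o m xs ys)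

acts-addMul : ∀ {n} (os : List (ColOp n)) m x y → acts os (addMul m x y) ≡ addMul m (acts os x) (acts os y)
acts-addMul []       m x y = refl
acts-addMul (o ∷ os) m x y = trans (cong (acts os) (act-addMul o m x y)) (acts-addMul os m (act o x) (act o y))

det-triangular : ∀ {n} h (rs : Vec (Vec ℤ (suc n)) n) →
  det ((h ∷ replicate n (+ 0)) ∷ rs) ≡ h ℤ.* minor rs zero
det-triangular {n} h rs = trans (det-laplace (h ∷ replicate n (+ 0)) rs)
  (trans (cong (λ x → + 1 ℤ.* (h ℤ.* minor rs zero) ℤ.+ x)
    (altSum-zero (- + 1) {λ j → lookup (replicate n (+ 0)) j ℤ.* minor rs (suc j)}
      (λ j → cong (ℤ._* minor rs (suc j)) (lookup-replicate j (+ 0))))) (e (h ℤ.* minor rs zero)))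
  where
  e : ∀ x → + 1 ℤ.* x ℤ.+ + 0 ≡ x
  e = solve-∀

det-reduce : ∀ {n} os h (r : Vec ℤ (suc n)) rs → acts os r ≡ h ∷ replicate n (+ 0) →
  det (r ∷ rs) ≡ h ℤ.* det (map (λ x → removeAt (acts os x) zero) rs)
det-reduce os h r rs eq = trans (sym (det-acts os (r ∷ rs)))
  (trans (cong (λ x → det (x ∷ map (acts os) rs)) eq)
  (trans (det-triangular h (map (acts os) rs)) (cong (h ℤ.*_) (minor-map (acts os) rs zero))))

-- The operations turn r into (h, 0, ..., 0), so a multiple of r alters only the first column, and
-- that column is deleted.
addMul-reduced : ∀ {n} os {h} {r : Vec ℤ (suc n)} → acts os r ≡ h ∷ replicate n (+ 0) → ∀ m x →
  removeAt (acts os (addMul m x r)) zero ≡ removeAt (acts os x) zero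
addMul-reduced os {h} {r} eq m x = trans (cong (λ z → removeAt z zero)
    (trans (acts-addMul os m x r) (cong (addMul m (acts os x)) eq)))
  (trans (removeAt-addMul m (acts os x) _ zero) (addMul-zeroʳ m _))

det-addMul-rest : ∀ {n} m (r : Vec ℤ (suc n)) rs →
  det (r ∷ map (λ x → addMul m x r) rs) ≡ det (r ∷ rs)
det-addMul-rest m r rs with reduce r
... | os , h , eq = trans (det-reduce os h r _ eq) (trans
  (cong (λ z → h ℤ.* det z) (trans (sym (map-∘ _ _ rs)) (map-cong (addMul-reduced os eq m) rs)))
  (sym (det-reduce os h r rs eq)))

det-addMul-second : ∀ {n} m (r s : Vec ℤ (suc (suc n))) rs →
  det (r ∷ addMul m s r ∷ rs) ≡ det (r ∷ s ∷ rs)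
det-addMul-second m r s rs with reduce r
... | os , h , eq = trans (det-reduce os h r _ eq) (trans
  (cong (λ z → h ℤ.* det (z ∷ _)) (addMul-reduced os eq m s))
  (sym (det-reduce os h r (s ∷ rs) eq)))

det-addMul : ∀ {n} m (r s : Vec ℤ (suc n)) rs → det (addMul m r s ∷ rs) ≡ det (r ∷ rs) ℤ.+ m ℤ.* det (s ∷ rs)
det-addMul m r s rs = trans (det-laplace (addMul m r s) rs) (trans
  (altSum-lin (+ 1) m {u = λ j → lookup r j ℤ.* minor rs j} {λ j → lookup s j ℤ.* minor rs j}
    (λ j → trans (cong (ℤ._* minor rs j) (lookup-addMul m r s j)) (e (lookup r j) (lookup s j) m (minor rs j))))
  (cong₂ (λ x y → x ℤ.+ m ℤ.* y) (sym (det-laplace r rs)) (sym (det-laplace s rs))))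
  where
  e : ∀ x y m g → (x ℤ.+ m ℤ.* y) ℤ.* g ≡ x ℤ.* g ℤ.+ m ℤ.* (y ℤ.* g)
  e = solve-∀

-- Reducing the first row reduces the second as well; without its first entry the second is a zero
-- row, which is the triangular case with pivot 0.
det-equal-rows : ∀ {n} (r : Vec ℤ (suc (suc n))) rs → det (r ∷ r ∷ rs) ≡ + 0
det-equal-rows r rs with reduce r
... | os , h , eq = trans (det-reduce os h r _ eq)
  (trans (cong (λ z → h ℤ.* det (removeAt z zero ∷ rs′)) eq)
  (trans (cong (h ℤ.*_) (det-triangular (+ 0) rs′)) (ℤP.*-zeroʳ h)))
  where rs′ = map (λ x → removeAt (acts os x) zero) rs

addMul-comm : ∀ {n} (x y : Vec ℤ n) → addMul (+ 1) x y ≡ addMul (+ 1) y x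
addMul-comm [] [] = refl
addMul-comm (x ∷ xs) (y ∷ ys) = cong₂ _∷_ (e x y) (addMul-comm xs ys)
  where
  e : ∀ x y → x ℤ.+ + 1 ℤ.* y ≡ y ℤ.+ + 1 ℤ.* x
  e = solve-∀

data Swap {A : Set} : ∀ {n} → Vec A n → Vec A n → Set where
  here  : ∀ {n x y} {xs : Vec A n} → Swap (x ∷ y ∷ xs) (y ∷ x ∷ xs)
  there : ∀ {n x} {xs ys : Vec A n} → Swap xs ys → Swap (x ∷ xs) (x ∷ ys)

swap-map : ∀ {A B : Set} (f : A → B) {n} {xs ys : Vec A n} → Swap xs ys → Swap (map f xs) (map f ys)
swap-map f here      = here
swap-map f (there s) = there (swap-map f s)

-- Polarisation for the first two rows: the determinant with r + s in both places vanishes and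
-- expands to the sum of the two orders. Deeper swaps pass to the minors.
det-swap : ∀ {n} {E E′ : Mat n} → Swap E E′ → det E′ ≡ - det E
det-swap {suc (suc n)} (here {x = r} {y = s} {xs = rs}) =
  e (det (r ∷ s ∷ rs)) (det (s ∷ r ∷ rs)) (trans (sym expansion) (det-equal-rows (addMul (+ 1) r s) rs))
  where
  expansion : det (addMul (+ 1) r s ∷ addMul (+ 1) r s ∷ rs) ≡ det (r ∷ s ∷ rs) ℤ.+ + 1 ℤ.* det (s ∷ r ∷ rs)
  expansion = trans (det-addMul (+ 1) r s (addMul (+ 1) r s ∷ rs)) (cong₂ (λ x y → x ℤ.+ + 1 ℤ.* y)
    (trans (cong (λ z → det (r ∷ z ∷ rs)) (addMul-comm r s)) (det-addMul-second (+ 1) r s rs))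
    (det-addMul-second (+ 1) s r rs))
  e : ∀ a b → a ℤ.+ + 1 ℤ.* b ≡ + 0 → b ≡ - a
  e a b eq = trans (e₁ a b) (trans (cong (ℤ._- a) eq) (ℤP.+-identityˡ (- a)))
    where
    e₁ : ∀ a b → b ≡ a ℤ.+ + 1 ℤ.* b ℤ.- a
    e₁ = solve-∀
det-swap {suc n} (there {x = r} {xs = rs} {ys = rs′} s) = trans (det-laplace r rs′)
  (trans (altSum-lin (+ 1) (- + 1) {u = λ _ → + 0} {λ j → lookup r j ℤ.* minor rs j}
    (λ j → trans (cong (lookup r j ℤ.*_) (det-swap (swap-map (λ row → removeAt row j) s))) (e (lookup r j) (minor rs j))))
  (trans (cong₂ (λ x y → x ℤ.+ - + 1 ℤ.* y) (altSum-zero (+ 1) {λ (_ : Fin (suc n)) → + 0} (λ _ → refl))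
    (sym (det-laplace r rs))) (e₁ (det (r ∷ rs)))))
  where
  e : ∀ x y → x ℤ.* - y ≡ + 0 ℤ.+ - + 1 ℤ.* (x ℤ.* y)
  e = solve-∀
  e₁ : ∀ y → + 0 ℤ.+ - + 1 ℤ.* y ≡ - y
  e₁ = solve-∀

-- Lattice points in half-open boxes

unact : ∀ {n} → ColOp n → Vec ℤ n → Vec ℤ n
unact (addL m) = act (addL (- m))
unact (addR m) = act (addR (- m))
unact (skip o) (x ∷ r) = x ∷ unact o r

cancel-addMul : ∀ m x y → x ℤ.+ - m ℤ.* y ℤ.+ m ℤ.* y ≡ x
cancel-addMul = solve-∀

cancel-addMul′ : ∀ m x y → x ℤ.+ m ℤ.* y ℤ.+ - m ℤ.* y ≡ x
cancel-addMul′ = solve-∀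

act-unact : ∀ {n} (o : ColOp n) x → act o (unact o x) ≡ x
act-unact (addL m) (x ∷ y ∷ r) = cong (_∷ y ∷ r) (cancel-addMul m x y)
act-unact (addR m) (x ∷ y ∷ r) = cong (λ z → x ∷ z ∷ r) (cancel-addMul m y x)
act-unact (skip o) (x ∷ r) = cong (x ∷_) (act-unact o r)

unact-act : ∀ {n} (o : ColOp n) x → unact o (act o x) ≡ x
unact-act (addL m) (x ∷ y ∷ r) = cong (_∷ y ∷ r) (cancel-addMul′ m x y)
unact-act (addR m) (x ∷ y ∷ r) = cong (λ z → x ∷ z ∷ r) (cancel-addMul′ m y x)
unact-act (skip o) (x ∷ r) = cong (x ∷_) (unact-act o r)

unacts : ∀ {n} → List (ColOp n) → Vec ℤ n → Vec ℤ n
unacts []       x = x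
unacts (o ∷ os) x = unact o (unacts os x)

acts-unacts : ∀ {n} (os : List (ColOp n)) x → acts os (unacts os x) ≡ x
acts-unacts []       x = refl
acts-unacts (o ∷ os) x = trans (cong (acts os) (act-unact o _)) (acts-unacts os x)

unacts-acts : ∀ {n} (os : List (ColOp n)) x → unacts os (acts os x) ≡ x
unacts-acts []       x = refl
unacts-acts (o ∷ os) x = trans (cong (unact o) (unacts-acts os (act o x))) (unact-act o x)

acts-injective : ∀ {n} (os : List (ColOp n)) {x y} → acts os x ≡ acts os y → x ≡ y
acts-injective os {x} {y} eq = trans (sym (unacts-acts os x)) (trans (cong (unacts os) eq) (unacts-acts os y))

act-scale : ∀ {n} (o : ColOp n) m x → act o (m ·ᵥ x) ≡ m ·ᵥ act o x
act-scale (addL k) m (x ∷ y ∷ r) = cong (_∷ _) (e k (+ m) x y)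
  where
  e : ∀ k m x y → m ℤ.* x ℤ.+ k ℤ.* (m ℤ.* y) ≡ m ℤ.* (x ℤ.+ k ℤ.* y)
  e = solve-∀
act-scale (addR k) m (x ∷ y ∷ r) = cong (λ z → _ ∷ z ∷ _) (e k (+ m) y x)
  where
  e : ∀ k m x y → m ℤ.* x ℤ.+ k ℤ.* (m ℤ.* y) ≡ m ℤ.* (x ℤ.+ k ℤ.* y)
  e = solve-∀
act-scale (skip o) m (x ∷ r) = cong (_ ∷_) (act-scale o m r)

acts-scale : ∀ {n} (os : List (ColOp n)) m x → acts os (m ·ᵥ x) ≡ m ·ᵥ acts os x
acts-scale []       m x = refl
acts-scale (o ∷ os) m x = trans (cong (acts os) (act-scale o m x)) (acts-scale os m (act o x))

act-zero : ∀ {n} (o : ColOp n) → act o (replicate n (+ 0)) ≡ replicate n (+ 0)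
act-zero (addL m) = cong (_∷ _) (trans (ℤP.+-identityˡ (m ℤ.* + 0)) (ℤP.*-zeroʳ m))
act-zero (addR m) = cong (λ z → _ ∷ z ∷ _) (trans (ℤP.+-identityˡ (m ℤ.* + 0)) (ℤP.*-zeroʳ m))
act-zero (skip o) = cong (_ ∷_) (act-zero o)

acts-zero : ∀ {n} (os : List (ColOp n)) → acts os (replicate n (+ 0)) ≡ replicate n (+ 0)
acts-zero []       = refl
acts-zero (o ∷ os) = trans (cong (acts os) (act-zero o)) (acts-zero os)

lin : ∀ {m n} → Vec ℤ m → Vec (Vec ℤ n) m → Vec ℤ n
lin []       []       = replicate _ (+ 0)
lin (c ∷ cs) (e ∷ es) = addMul c (lin cs es) e

acts-lin : ∀ {m n} (os : List (ColOp n)) (c : Vec ℤ m) E → acts os (lin c E) ≡ lin c (map (acts os) E)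
acts-lin os []       []       = acts-zero os
acts-lin os (c ∷ cs) (e ∷ es) = trans (acts-addMul os c (lin cs es) e)
  (cong (λ z → addMul c z (acts os e)) (acts-lin os cs es))

removeAt-replicate : ∀ {A : Set} n (x : A) j → removeAt (replicate (suc n) x) j ≡ replicate n x
removeAt-replicate n       x zero    = refl
removeAt-replicate (suc n) x (suc j) = cong (x ∷_) (removeAt-replicate n x j)

removeAt-lin : ∀ {m n} (c : Vec ℤ m) (E : Vec (Vec ℤ (suc n)) m) j →
  removeAt (lin c E) j ≡ lin c (map (λ r → removeAt r j) E)
removeAt-lin []       []       j = removeAt-replicate _ (+ 0) j
removeAt-lin (c ∷ cs) (e ∷ es) j = trans (removeAt-addMul c (lin cs es) e j)
  (cong (λ z → addMul c z (removeAt e j)) (removeAt-lin cs es j))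

scale-addMul : ∀ {n} k c (x y : Vec ℤ n) → addMul (+ k ℤ.* c) (k ·ᵥ x) y ≡ k ·ᵥ addMul c x y
scale-addMul k c []       []       = refl
scale-addMul k c (x ∷ xs) (y ∷ ys) = cong₂ _∷_ (e (+ k) c x y) (scale-addMul k c xs ys)
  where
  e : ∀ k c x y → k ℤ.* x ℤ.+ k ℤ.* c ℤ.* y ≡ k ℤ.* (x ℤ.+ c ℤ.* y)
  e = solve-∀

scale-zero : ∀ n k → k ·ᵥ replicate n (+ 0) ≡ replicate n (+ 0)
scale-zero zero    k = refl
scale-zero (suc n) k = cong₂ _∷_ (ℤP.*-zeroʳ (+ k)) (scale-zero n k)

scale-∘ : ∀ {n} k m (x : Vec ℤ n) → k ·ᵥ (m ·ᵥ x) ≡ (k * m) ·ᵥ x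
scale-∘ k m []       = refl
scale-∘ k m (x ∷ xs) = cong₂ _∷_
  (trans (sym (ℤP.*-assoc (+ k) (+ m) x)) (cong (ℤ._* x) (sym (ℤP.pos-* k m)))) (scale-∘ k m xs)

lin-scale : ∀ {m n} k (c : Vec ℕ m) (E : Vec (Vec ℤ n) m) →
  lin (map +_ (map (k *_) c)) E ≡ k ·ᵥ lin (map +_ c) E
lin-scale k []       []       = sym (scale-zero _ k)
lin-scale k (c ∷ cs) (e ∷ es) = trans
  (cong₂ (λ z w → addMul z w e) (ℤP.pos-* k c) (lin-scale k cs es))
  (scale-addMul k (+ c) _ e)

prod : ∀ {n} → Vec ℕ n → ℕ
prod []       = 1
prod (x ∷ xs) = x * prod xs

-- D·∏b lattice points in the half-open box {Σ tᵢ eᵢ : 0 ≤ tᵢ < bᵢ} spanned by the rows of E,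
-- each with the numerators of its coordinates tᵢ over the denominator D.
record BoxPoints {n} (D : ℕ) (E : Mat n) (b : Vec ℕ n) : Set where
  field
    count      : ℕ
    count≡     : count ≡ D * prod b
    point      : Fin count → Vec ℤ n
    injective  : ∀ {i j} → point i ≡ point j → i ≡ j
    coord      : Fin count → Vec ℕ n
    point-lin  : ∀ i → D ·ᵥ point i ≡ lin (map +_ (coord i)) E
    coord<     : ∀ i j → lookup (coord i) j ℕ.< D * lookup b j

-- Column operations are bijections of the ambient lattice and fix coordinates relative to the rows,
-- so only the points are transported.
boxPoints-acts : ∀ {n D} os (E : Mat n) b → BoxPoints D (map (acts os) E) b → BoxPoints D E b
boxPoints-acts {D = D} os E b B = record
  { count     = count
  ; count≡    = count≡
  ; point     = unacts os ∘ point
  ; injective = λ {i} {j} eq → injective (trans (sym (acts-unacts os (point i)))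
      (trans (cong (acts os) eq) (acts-unacts os (point j))))
  ; coord     = coord
  ; point-lin = λ i → acts-injective os (trans (acts-scale os D _)
      (trans (cong (D ·ᵥ_) (acts-unacts os (point i)))
      (trans (point-lin i) (sym (acts-lin os (map +_ (coord i)) E)))))
  ; coord<    = coord<
  }
  where open BoxPoints B

data IsUnit : ℤ → Set where
  plus  : IsUnit (+ 1)
  minus : IsUnit (- + 1)

unit-square : ∀ {σ} → IsUnit σ → σ ℤ.* σ ≡ + 1
unit-square plus  = refl
unit-square minus = refl

signum : ∀ h → ∃ λ σ → IsUnit σ × h ≡ σ ℤ.* + ∣ h ∣
signum (+ n)      = + 1 , plus , sym (ℤP.*-identityˡ (+ n))
signum ℤ.-[1+ n ] = - + 1 , minus , sym (ℤP.-1*i≡-i (+ suc n))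

-- The first integer met when leaving S / D in direction σ: the ceiling for `plus`, the floor for
-- `minus`.
roundTowards : ∀ {σ} → IsUnit σ → ∀ S D .{{_ : ℕ.NonZero D}} →
  ∃₂ λ u r → r ℕ.< D × + D ℤ.* u ≡ S ℤ.+ σ ℤ.* + r
roundTowards plus S D = - ((- S) ℤD./ℕ D) , (- S) ℤD.%ℕ D , ℤD.n%ℕd<d (- S) D ,
  trans (e₁ (+ D) ((- S) ℤD./ℕ D) (+ ((- S) ℤD.%ℕ D))) (trans (cong (λ z → - z ℤ.+ + ((- S) ℤD.%ℕ D))
    (sym (ℤD.a≡a%ℕn+[a/ℕn]*n (- S) D))) (e₂ S _))
  where
  e₁ : ∀ D q r → D ℤ.* - q ≡ - (r ℤ.+ q ℤ.* D) ℤ.+ r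
  e₁ = solve-∀
  e₂ : ∀ S r → - (- S) ℤ.+ r ≡ S ℤ.+ + 1 ℤ.* r
  e₂ = solve-∀
roundTowards minus S D = S ℤD./ℕ D , S ℤD.%ℕ D , ℤD.n%ℕd<d S D ,
  trans (e₁ (+ D) (S ℤD./ℕ D) (+ (S ℤD.%ℕ D))) (cong (λ z → z ℤ.+ - + 1 ℤ.* + (S ℤD.%ℕ D)) (sym (ℤD.a≡a%ℕn+[a/ℕn]*n S D)))
  where
  e₁ : ∀ D q r → D ℤ.* q ≡ r ℤ.+ q ℤ.* D ℤ.+ - + 1 ℤ.* r
  e₁ = solve-∀

-- Over each point of the lower box lies a half-open segment along the first row. Its length
-- `H * b₀` is an integer, so it holds exactly that many integers, the first being `S i / D′`
-- rounded in the direction of the sign of `h`.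
module Triangular {n} (h : ℤ) (D′ : ℕ) (rs : Vec (Vec ℤ (suc n)) n) (b₀ : ℕ) (b : Vec ℕ n)
  (B : BoxPoints D′ (map (λ r → removeAt r zero) rs) b) where

  open BoxPoints B

  E : Mat (suc n)
  E = (h ∷ replicate n (+ 0)) ∷ rs
  H : ℕ
  H = ∣ h ∣

  -- With `D′` zero there would be no index, so every index brings along the divisor that rounding
  -- needs.
  D′≢0 : Fin count → ℕ.NonZero D′
  D′≢0 i = ℕ.≢-nonZero λ D′≡0 → FinP.¬Fin0 (subst Fin (trans count≡ (cong (_* prod b) D′≡0)) i)

  σ : ℤ
  σ = proj₁ (signum h)

  combo : Fin count → Vec ℤ (suc n)
  combo i = lin (map +_ (coord i)) rs
  S : Fin count → ℤ
  S i = lookup (combo i) zero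

  offset : ∀ i → ∃₂ λ u r → r ℕ.< D′ × + D′ ℤ.* u ≡ S i ℤ.+ σ ℤ.* + r
  offset i = roundTowards (proj₁ (proj₂ (signum h))) (S i) D′ {{D′≢0 i}}

  newCount : ℕ
  newCount = (H * b₀) * count

  pt : Fin (H * b₀) × Fin count → Vec ℤ (suc n)
  pt (t , i) = proj₁ (offset i) ℤ.+ σ ℤ.* + toℕ t ∷ point i

  co : Fin (H * b₀) × Fin count → Vec ℕ (suc n)
  co (t , i) = proj₁ (proj₂ (offset i)) + D′ * toℕ t ∷ map (H *_) (coord i)

  pt-injective : ∀ p q → pt p ≡ pt q → p ≡ q
  pt-injective (t , i) (t′ , i′) eq with injective (proj₂ (∷-injective eq))
  ... | refl = cong (_, i) (FinP.toℕ-injective (ℤP.+-injective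
      (trans (e (proj₁ (offset i)) (+ toℕ t)) (trans (cong (λ z → σ ℤ.* (z ℤ.- proj₁ (offset i))) (proj₁ (∷-injective eq)))
        (sym (e (proj₁ (offset i)) (+ toℕ t′)))))))
    where
    e₁ : ∀ σ u t → σ ℤ.* (u ℤ.+ σ ℤ.* t ℤ.- u) ≡ σ ℤ.* σ ℤ.* t
    e₁ = solve-∀
    e : ∀ u t → t ≡ σ ℤ.* (u ℤ.+ σ ℤ.* t ℤ.- u)
    e u t = sym (trans (e₁ σ u t) (trans (cong (ℤ._* t) (unit-square (proj₁ (proj₂ (signum h))))) (ℤP.*-identityˡ t)))

  head-tail : ∀ {n} (v : Vec ℤ (suc n)) → v ≡ lookup v zero ∷ removeAt v zero
  head-tail (x ∷ v) = refl

  pt-lin : ∀ p → (H * D′) ·ᵥ pt p ≡ lin (map +_ (co p)) E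
  pt-lin (t , i) = sym (begin
    addMul (+ c₀) (lin (map +_ (map (H *_) (coord i))) rs) (h ∷ replicate n (+ 0))
      ≡⟨ cong (λ z → addMul (+ c₀) z (h ∷ replicate n (+ 0))) (trans (lin-scale H (coord i) rs) (cong (H ·ᵥ_) (head-tail (combo i)))) ⟩
    (+ H ℤ.* S i ℤ.+ + c₀ ℤ.* h) ∷ addMul (+ c₀) (H ·ᵥ removeAt (combo i) zero) (replicate n (+ 0))
      ≡⟨ cong₂ _∷_ heads (addMul-zeroʳ (+ c₀) _) ⟩
    + (H * D′) ℤ.* (u ℤ.+ σ ℤ.* + toℕ t) ∷ H ·ᵥ removeAt (combo i) zero
      ≡⟨ cong (+ (H * D′) ℤ.* (u ℤ.+ σ ℤ.* + toℕ t) ∷_) (trans (cong (H ·ᵥ_)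
           (trans (removeAt-lin (map +_ (coord i)) rs zero) (sym (point-lin i)))) (scale-∘ H D′ (point i))) ⟩
    (H * D′) ·ᵥ pt (t , i) ∎)
    where
    open ≡-Reasoning
    u = proj₁ (offset i)
    r = proj₁ (proj₂ (offset i))
    c₀ = r + D′ * toℕ t
    e₁ : ∀ H σ r D t S → H ℤ.* S ℤ.+ (r ℤ.+ D ℤ.* t) ℤ.* (σ ℤ.* H) ≡ H ℤ.* (S ℤ.+ σ ℤ.* r) ℤ.+ H ℤ.* D ℤ.* (σ ℤ.* t)
    e₁ = solve-∀
    e₂ : ∀ H D u x → H ℤ.* (D ℤ.* u) ℤ.+ H ℤ.* D ℤ.* x ≡ H ℤ.* D ℤ.* (u ℤ.+ x)
    e₂ = solve-∀
    heads : + H ℤ.* S i ℤ.+ + c₀ ℤ.* h ≡ + (H * D′) ℤ.* (u ℤ.+ σ ℤ.* + toℕ t)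
    heads = begin
      + H ℤ.* S i ℤ.+ + c₀ ℤ.* h
        ≡⟨ cong₂ (λ c k → + H ℤ.* S i ℤ.+ c ℤ.* k)
             (trans (ℤP.pos-+ r _) (cong (λ z → + r ℤ.+ z) (ℤP.pos-* D′ (toℕ t)))) (proj₂ (proj₂ (signum h))) ⟩
      + H ℤ.* S i ℤ.+ (+ r ℤ.+ + D′ ℤ.* + toℕ t) ℤ.* (σ ℤ.* + H)
        ≡⟨ e₁ (+ H) σ (+ r) (+ D′) (+ toℕ t) (S i) ⟩
      + H ℤ.* (S i ℤ.+ σ ℤ.* + r) ℤ.+ + H ℤ.* + D′ ℤ.* (σ ℤ.* + toℕ t)
        ≡⟨ cong (λ z → + H ℤ.* z ℤ.+ + H ℤ.* + D′ ℤ.* (σ ℤ.* + toℕ t)) (sym (proj₂ (proj₂ (proj₂ (offset i))))) ⟩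
      + H ℤ.* (+ D′ ℤ.* u) ℤ.+ + H ℤ.* + D′ ℤ.* (σ ℤ.* + toℕ t)
        ≡⟨ e₂ (+ H) (+ D′) u _ ⟩
      + H ℤ.* + D′ ℤ.* (u ℤ.+ σ ℤ.* + toℕ t)
        ≡⟨ cong (ℤ._* (u ℤ.+ σ ℤ.* + toℕ t)) (sym (ℤP.pos-* H D′)) ⟩
      + (H * D′) ℤ.* (u ℤ.+ σ ℤ.* + toℕ t) ∎

  co< : ∀ p j → lookup (co p) j ℕ.< H * D′ * lookup (b₀ ∷ b) j
  co< (t , i) zero = begin-strict
    proj₁ (proj₂ (offset i)) + D′ * toℕ t <⟨ ℕP.+-monoˡ-< _ (proj₁ (proj₂ (proj₂ (offset i)))) ⟩
    D′ + D′ * toℕ t                       ≡⟨ ℕP.*-suc D′ (toℕ t) ⟨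
    D′ * suc (toℕ t)                        ≤⟨ ℕP.*-monoʳ-≤ D′ (FinP.toℕ<n t) ⟩
    D′ * (H * b₀)                         ≡⟨ trans (sym (ℕP.*-assoc D′ H b₀)) (cong (_* b₀) (ℕP.*-comm D′ H)) ⟩
    H * D′ * b₀                           ∎
    where open ℕP.≤-Reasoning
  co< (t , i) (suc j) rewrite lookup-map j (H *_) (coord i) = begin-strict
    H * lookup (coord i) j      <⟨ ℕP.*-monoʳ-< H {{H≢0}} (coord< i j) ⟩
    H * (D′ * lookup b j)     ≡⟨ ℕP.*-assoc H D′ (lookup b j) ⟨
    H * D′ * lookup b j       ∎
    where
    open ℕP.≤-Reasoning
    H≢0 : ℕ.NonZero H
    H≢0 = ℕ.≢-nonZero λ H≡0 → FinP.¬Fin0 (subst (λ z → Fin (z * b₀)) H≡0 t)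

  boxPoints : BoxPoints (H * D′) E (b₀ ∷ b)
  boxPoints = record
    { count     = newCount
    ; count≡    = trans (cong (H * b₀ *_) count≡) (swap₄ H b₀ D′ (prod b))
    ; point     = pt ∘ remQuot count
    ; injective = λ {i} {j} eq → remQuot-injective (pt-injective (remQuot count i) (remQuot count j) eq)
    ; coord     = co ∘ remQuot count
    ; point-lin = pt-lin ∘ remQuot count
    ; coord<    = co< ∘ remQuot count
    }
    where
    swap₄ : ∀ a b c d → a * b * (c * d) ≡ a * c * (b * d)
    swap₄ = ℕSolver.solve-∀
      where import Data.Nat.Tactic.RingSolver as ℕSolver
    remQuot-injective : ∀ {i j} → remQuot {H * b₀} count i ≡ remQuot count j → i ≡ j
    remQuot-injective {i} {j} eq = trans (sym (FinP.combine-remQuot {H * b₀} count i))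
      (trans (cong (λ { (t , k) → combine t k }) eq) (FinP.combine-remQuot {H * b₀} count j))

boxPoints : ∀ {n} (E : Mat n) b → BoxPoints ∣ det E ∣ E b
boxPoints [] [] = record
  { count = 1 ; count≡ = refl ; point = λ _ → [] ; injective = λ { {zero} {zero} _ → refl }
  ; coord = λ _ → [] ; point-lin = λ _ → refl ; coord< = λ _ () }
boxPoints (r ∷ rs) (b₀ ∷ b) with reduce r
... | os , h , eq = boxPoints-acts os (r ∷ rs) (b₀ ∷ b)
  (subst₂ (λ D z → BoxPoints D (z ∷ map (acts os) rs) (b₀ ∷ b))
    (trans (sym (ℤP.abs-* h _)) (cong ∣_∣ (trans (cong (h ℤ.*_) (minor-map (acts os) rs zero)) (sym (det-reduce os h r rs eq)))))
    (sym eq)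
    (Triangular.boxPoints h ∣ minor (map (acts os) rs) zero ∣ (map (acts os) rs) b₀ b (boxPoints _ b)))

-- Reordering the vertices

addᵥ-comm : ∀ {n} m (x y : Vec ℤ n) → (m ·ᵥ y) +ᵥ x ≡ addMul (+ m) x y
addᵥ-comm m []       []       = refl
addᵥ-comm m (x ∷ xs) (y ∷ ys) = cong₂ _∷_ (ℤP.+-comm (+ m ℤ.* y) x) (addᵥ-comm m xs ys)

vsum-lin : ∀ {d n} (μ : Vec ℕ n) (v : Vec (Point d) n) → vsum (zipWith _·ᵥ_ μ v) ≡ lin (map +_ μ) v
vsum-lin []      []      = refl
vsum-lin (m ∷ μ) (p ∷ v) = trans (cong ((m ·ᵥ p) +ᵥ_) (vsum-lin μ v)) (addᵥ-comm m _ p)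

swap-sym : ∀ {A : Set} {n} {xs ys : Vec A n} → Swap xs ys → Swap ys xs
swap-sym here      = here
swap-sym (there s) = there (swap-sym s)

swap-All : ∀ {A : Set} {P : A → Set} {n} {xs ys : Vec A n} → Swap xs ys → All P xs → All P ys
swap-All here      (p ∷ q ∷ ps) = q ∷ p ∷ ps
swap-All (there s) (p ∷ ps)     = p ∷ swap-All s ps

swapLike : ∀ {A B : Set} {n} {xs ys : Vec A n} → Swap xs ys → Vec B n → Vec B n
swapLike here      (x ∷ y ∷ zs) = y ∷ x ∷ zs
swapLike (there s) (x ∷ zs)     = x ∷ swapLike s zs

swapLike-Swap : ∀ {A B : Set} {n} {xs ys : Vec A n} (s : Swap xs ys) (zs : Vec B n) → Swap zs (swapLike s zs)
swapLike-Swap here      (x ∷ y ∷ zs) = here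
swapLike-Swap (there s) (x ∷ zs)     = there (swapLike-Swap s zs)

swapLike-map : ∀ {A B C : Set} (f : A → B) (g : A → C) {n} {xs ys : Vec A n} (s : Swap xs ys) →
  swapLike (swap-map f s) (map g xs) ≡ map g ys
swapLike-map f g here      = refl
swapLike-map f g (there s) = cong (_ ∷_) (swapLike-map f g s)

swap-sum : ∀ {n} {xs ys : Vec ℕ n} → Swap xs ys → sum ys ≡ sum xs
swap-sum (here {x = x} {y} {xs}) = e x y (sum xs)
  where
  e : ∀ x y z → y + (x + z) ≡ x + (y + z)
  e = ℕSolver.solve-∀
swap-sum (there s) = cong (_ ℕ.+_) (swap-sum s)

addMul-swap : ∀ {n} a b (x y z : Vec ℤ n) → addMul a (addMul b z y) x ≡ addMul b (addMul a z x) y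
addMul-swap a b []       []       []       = refl
addMul-swap a b (x ∷ xs) (y ∷ ys) (z ∷ zs) = cong₂ _∷_ (e a b x y z) (addMul-swap a b xs ys zs)
  where
  e : ∀ a b x y z → z ℤ.+ b ℤ.* y ℤ.+ a ℤ.* x ≡ z ℤ.+ a ℤ.* x ℤ.+ b ℤ.* y
  e = solve-∀

swap-lin : ∀ {d n} {v v′ : Vec (Point d) n} (s : Swap v v′) (μ : Vec ℕ n) →
  lin (map +_ (swapLike s μ)) v′ ≡ lin (map +_ μ) v
swap-lin (here {x = p} {q} {v}) (a ∷ b ∷ μ) = addMul-swap (+ b) (+ a) q p (lin (map +_ μ) v)
swap-lin (there s) (a ∷ μ) = cong (λ z → addMul (+ a) z _) (swap-lin s μ)

swap-interior : ∀ {d} {v v′ : Vertices d} {x} → Swap v v′ → InInterior v x → InInterior v′ x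
swap-interior {v = v} {v′} {x} s (μ , μ≥1 , eq) = swapLike s μ , swap-All (swapLike-Swap s μ) μ≥1 ,
  trans (cong (_·ᵥ x) (swap-sum (swapLike-Swap s μ)))
  (trans eq (trans (vsum-lin μ v) (trans (sym (swap-lin s μ)) (sym (vsum-lin (swapLike s μ) v′)))))

swap-HasCard : ∀ {d l k} {v v′ : Vertices d} → Swap v v′ → HasCard (Il l v) k → HasCard (Il l v′) k
swap-HasCard s (L , unique , len , mem) = L , unique , len , λ x → mk⇔
  (λ x∈L → let (i , r) = Equivalence.to (mem x) x∈L in swap-interior s i , r)
  (λ (i , r) → Equivalence.from (mem x) (swap-interior (swap-sym s) i , r))

-- Exchanging the base vertex p with q turns the edges q - p and x - p into -(q - p) and (x - p) -
-- (q - p), so the determinant only changes sign.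
swap-normVol : ∀ {d} {v v′ : Vertices d} → Swap v v′ → normVol v′ ≡ normVol v
swap-normVol (here {x = p} {q} {v}) = trans (cong ∣_∣ (begin
  det ((p -ᵥ q) ∷ map (_-ᵥ q) v)
    ≡⟨ cong₂ (λ r rs → det (r ∷ rs)) (neg p q) (trans (map-cong (diff p q) v) (map-∘ _ _ v)) ⟩
  -- The negated row is written as the row minus twice itself, which linearity in the first row can
  -- handle.
  det (addMul (- + 2) (q -ᵥ p) (q -ᵥ p) ∷ map (λ x → addMul (- + 1) x (q -ᵥ p)) (map (_-ᵥ p) v))
    ≡⟨ det-addMul (- + 2) (q -ᵥ p) (q -ᵥ p) _ ⟩
  det ((q -ᵥ p) ∷ _) ℤ.+ - + 2 ℤ.* det ((q -ᵥ p) ∷ _)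
    ≡⟨ e _ ⟩
  - det ((q -ᵥ p) ∷ map (λ x → addMul (- + 1) x (q -ᵥ p)) (map (_-ᵥ p) v))
    ≡⟨ cong -_ (det-addMul-rest (- + 1) (q -ᵥ p) (map (_-ᵥ p) v)) ⟩
  - det ((q -ᵥ p) ∷ map (_-ᵥ p) v) ∎)) (ℤP.∣-i∣≡∣i∣ (det ((q -ᵥ p) ∷ map (_-ᵥ p) v)))
  where
  open ≡-Reasoning
  e : ∀ x → x ℤ.+ - + 2 ℤ.* x ≡ - x
  e = solve-∀
  e₁ : ∀ p q → p ℤ.- q ≡ q ℤ.- p ℤ.+ - + 2 ℤ.* (q ℤ.- p)
  e₁ = solve-∀
  e₂ : ∀ p q x → x ℤ.- q ≡ x ℤ.- p ℤ.+ - + 1 ℤ.* (q ℤ.- p)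
  e₂ = solve-∀
  neg : ∀ {n} (p q : Vec ℤ n) → p -ᵥ q ≡ addMul (- + 2) (q -ᵥ p) (q -ᵥ p)
  neg []       []       = refl
  neg (p ∷ ps) (q ∷ qs) = cong₂ _∷_ (e₁ p q) (neg ps qs)
  diff : ∀ {n} (p q x : Vec ℤ n) → x -ᵥ q ≡ addMul (- + 1) (x -ᵥ p) (q -ᵥ p)
  diff []       []       []       = refl
  diff (p ∷ ps) (q ∷ qs) (x ∷ xs) = cong₂ _∷_ (e₂ p q x) (diff ps qs xs)
swap-normVol {v = p ∷ v} (there s) = trans (cong ∣_∣ (det-swap (swap-map (_-ᵥ p) s))) (ℤP.∣-i∣≡∣i∣ (det (map (_-ᵥ p) v)))

-- Sorting returns a chain of adjacent transpositions, because the invariance of the volume and of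
-- the point count is proved for single ones.
module Sort {A : Set} {_≽_ : A → A → Set} (total : Total _≽_) (≽-trans : Transitive _≽_) where

  swaps-All : ∀ {P : A → Set} {n} {xs ys : Vec A n} → Star Swap xs ys → All P xs → All P ys
  swaps-All ε        ps = ps
  swaps-All (s ◅ ss) ps = swaps-All ss (swap-All s ps)

  insert : ∀ {n} x {xs : Vec A n} → AllPairs _≽_ xs → ∃ λ ys → Star Swap (x ∷ xs) ys × AllPairs _≽_ ys
  insert x [] = x ∷ [] , ε , [] ∷ []
  insert x {y ∷ xs} (y≽ ∷ sorted) with total x y
  ... | inj₁ x≽y = x ∷ y ∷ xs , ε , (x≽y ∷ All.map (≽-trans x≽y) y≽) ∷ y≽ ∷ sorted
  ... | inj₂ y≽x with insert x sorted
  ...   | ys , ss , sorted′ = y ∷ ys , here ◅ gmap (y ∷_) there ss , swaps-All ss (y≽x ∷ y≽) ∷ sorted′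

  sort : ∀ {n} (xs : Vec A n) → ∃ λ ys → Star Swap xs ys × AllPairs _≽_ ys
  sort []       = [] , ε , []
  sort (x ∷ xs) with sort xs
  ... | ys , ss , sorted with insert x sorted
  ...   | zs , ss′ , sorted′ = zs , gmap (x ∷_) there ss ◅◅ ss′ , sorted′

-- Counting lattice points around an interior point

lookup-ext : ∀ {A : Set} {n} {x y : Vec A n} → (∀ j → lookup x j ≡ lookup y j) → x ≡ y
lookup-ext {x = x} {y} eq = trans (sym (tabulate∘lookup x)) (trans (tabulate-cong eq) (tabulate∘lookup y))

pos-difference : ∀ {x y} → y ℕ.< x → ∃ λ m → 1 ≤ m × + m ≡ + x ℤ.- + y
pos-difference {x} {y} y<x = x ∸ y , ℕP.m<n⇒0<n∸m y<x ,
  sym (trans (ℤP.m-n≡m⊖n x y) (ℤP.⊖-≥ (ℕP.<⇒≤ y<x)))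

-- The weights are μ = K·a + c - c′, kept positive by c′ < K·a. They serve as the weights of the
-- shifted point away from the base vertex, with a the weights of w and c, c′ the coordinates of two
-- box points.
shiftedWeights : ∀ {n} K (a c c′ : Vec ℕ n) → (∀ j → lookup c′ j ℕ.< K * lookup a j) →
  ∃ λ μ → All (1 ≤_) μ × + sum μ ≡ + K ℤ.* + sum a ℤ.+ + sum c ℤ.- + sum c′ ×
    (∀ {d} (V : Vec (Point d) n) j → lookup (lin (map +_ μ) V) j ≡
      + K ℤ.* lookup (lin (map +_ a) V) j ℤ.+ lookup (lin (map +_ c) V) j ℤ.- lookup (lin (map +_ c′) V) j)
shiftedWeights K [] [] [] _ = [] , [] , e (+ K) , λ { [] j → eq j }
  where
  e : ∀ K → + 0 ≡ K ℤ.* + 0 ℤ.+ + 0 ℤ.- + 0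
  e = solve-∀
  eq : ∀ {d} (j : Fin d) → lookup (replicate d (+ 0)) j ≡
    + K ℤ.* lookup (replicate d (+ 0)) j ℤ.+ lookup (replicate d (+ 0)) j ℤ.- lookup (replicate d (+ 0)) j
  eq j rewrite lookup-replicate j (+ 0) = e (+ K)
shiftedWeights K (a ∷ as) (c ∷ cs) (c′ ∷ cs′) bound
  with shiftedWeights K as cs cs′ (bound ∘ suc)
     | pos-difference {K * a + c} {c′} (ℕP.<-≤-trans (bound zero) (ℕP.m≤m+n _ c))
... | μ , μ≥1 , sum≡ , lin≡ | m , m≥1 , m≡ = m ∷ μ , m≥1 ∷ μ≥1 , sum-eq , lin-eq
  where
  m≡′ : + m ≡ + K ℤ.* + a ℤ.+ + c ℤ.- + c′
  m≡′ = trans m≡ (cong (ℤ._- + c′) (trans (ℤP.pos-+ (K * a) c) (cong (ℤ._+ + c) (ℤP.pos-* K a))))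
  e₁ : ∀ K a c c′ A C C′ → K ℤ.* a ℤ.+ c ℤ.- c′ ℤ.+ (K ℤ.* A ℤ.+ C ℤ.- C′) ≡
    K ℤ.* (a ℤ.+ A) ℤ.+ (c ℤ.+ C) ℤ.- (c′ ℤ.+ C′)
  e₁ = solve-∀
  sum-eq : + (m + sum μ) ≡ + K ℤ.* + (a + sum as) ℤ.+ + (c + sum cs) ℤ.- + (c′ + sum cs′)
  sum-eq = trans (cong₂ ℤ._+_ m≡′ sum≡) (e₁ (+ K) (+ a) (+ c) (+ c′) (+ sum as) (+ sum cs) (+ sum cs′))
  e₂ : ∀ K a c c′ A C C′ v → K ℤ.* A ℤ.+ C ℤ.- C′ ℤ.+ (K ℤ.* a ℤ.+ c ℤ.- c′) ℤ.* v ≡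
    K ℤ.* (A ℤ.+ a ℤ.* v) ℤ.+ (C ℤ.+ c ℤ.* v) ℤ.- (C′ ℤ.+ c′ ℤ.* v)
  e₂ = solve-∀
  lin-eq : ∀ {d} (V : Vec (Point d) _) j → lookup (lin (map +_ (m ∷ μ)) V) j ≡
      + K ℤ.* lookup (lin (map +_ (a ∷ as)) V) j ℤ.+ lookup (lin (map +_ (c ∷ cs)) V) j ℤ.- lookup (lin (map +_ (c′ ∷ cs′)) V) j
  lin-eq (p ∷ V) j = trans (lookup-addMul (+ m) (lin (map +_ μ) V) p j)
    (trans (cong₂ (λ x y → x ℤ.+ y ℤ.* lookup p j) (lin≡ V j) m≡′)
    (trans (e₂ (+ K) (+ a) (+ c) (+ c′) (lookup (lin (map +_ as) V) j)
      (lookup (lin (map +_ cs) V) j) (lookup (lin (map +_ cs′) V) j) (lookup p j))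
    (sym (cong₂ ℤ._-_ (cong₂ (λ x y → + K ℤ.* x ℤ.+ y) (lookup-addMul (+ a) (lin (map +_ as) V) p j)
      (lookup-addMul (+ c) (lin (map +_ cs) V) p j)) (lookup-addMul (+ c′) (lin (map +_ cs′) V) p j)))))

lookup-lin-edges : ∀ {d n} (c : Vec ℕ n) (V : Vec (Point d) n) p j →
  lookup (lin (map +_ c) (map (_-ᵥ p) V)) j ≡ lookup (lin (map +_ c) V) j ℤ.- + sum c ℤ.* lookup p j
lookup-lin-edges [] [] p j rewrite lookup-replicate j (+ 0) = refl
lookup-lin-edges (c ∷ cs) (q ∷ V) p j
  rewrite lookup-addMul (+ c) (lin (map +_ cs) (map (_-ᵥ p) V)) (q -ᵥ p) j
        | lookup-addMul (+ c) (lin (map +_ cs) V) q j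
        | lookup-lin-edges cs V p j
        | lookup-zipWith ℤ._-_ j q p
        = e (+ c) (+ sum cs) (lookup (lin (map +_ cs) V) j) (lookup q j) (lookup p j)
  where
  e : ∀ c C L q p → L ℤ.- C ℤ.* p ℤ.+ c ℤ.* (q ℤ.- p) ≡ L ℤ.+ c ℤ.* q ℤ.- (c ℤ.+ C) ℤ.* p
  e = solve-∀

sum-bound : ∀ {n} (c : Vec ℕ n) B → (∀ j → lookup c j ℕ.< B) → sum c + n ≤ n * B
sum-bound []       B c<B = ℕ.z≤n
sum-bound {suc n} (c ∷ cs) B c<B = begin
  c + sum cs + suc n     ≡⟨ e c (sum cs) n ⟩
  suc c + (sum cs + n)   ≤⟨ ℕP.+-mono-≤ (c<B zero) (sum-bound cs B (c<B ∘ suc)) ⟩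
  B + n * B              ∎
  where
  open ℕP.≤-Reasoning
  e : ∀ c s n → c + s + (1 + n) ≡ 1 + c + (s + n)
  e = ℕSolver.solve-∀

jointly-injective⇒≤ : ∀ {m n p} (f : Fin m → Fin n) (g : Fin m → Fin p) →
  (∀ {i j} → f i ≡ f j → g i ≡ g j → i ≡ j) → m ≤ n * p
jointly-injective⇒≤ f g inj = FinP.injective⇒≤ {f = λ i → combine (f i) (g i)} λ {i} {j} eq →
  let (eq₁ , eq₂) = FinP.combine-injective (f i) (g i) (f j) (g j) eq in inj eq₁ eq₂

-- The factor T = D·d·N clears both denominators: T·w is K times the weighted vertices of w, and
-- T·l·y is D·(x - x′), a combination of edges by the box coordinates.
barycentric-shift : ∀ {T D d N M l K a₀ m A C C′ L P P′ v₀ w x x′ : ℤ} y →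
  T ≡ D ℤ.* d ℤ.* N → M ≡ l ℤ.* (d ℤ.* N) → K ≡ D ℤ.* d → N ℤ.* w ≡ A ℤ.+ a₀ ℤ.* v₀ →
  D ℤ.* x ≡ P ℤ.- C ℤ.* v₀ → D ℤ.* x′ ≡ P′ ℤ.- C′ ℤ.* v₀ → x ℤ.- x′ ≡ M ℤ.* y →
  m ≡ K ℤ.* a₀ ℤ.+ C′ ℤ.- C → L ≡ K ℤ.* A ℤ.+ P ℤ.- P′ →
  T ℤ.* (w ℤ.+ l ℤ.* y) ≡ L ℤ.+ m ℤ.* v₀
barycentric-shift {D = D} {d} {N} {l = l} {a₀ = a₀} {A = A} {C} {C′} {P = P} {P′} {v₀} {w} {x} {x′} y refl refl refl w-eq x-eq x′-eq diff refl refl =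
  begin
  D ℤ.* d ℤ.* N ℤ.* (w ℤ.+ l ℤ.* y)
    ≡⟨ e₁ D d N w l y ⟩
  D ℤ.* d ℤ.* (N ℤ.* w) ℤ.+ D ℤ.* (l ℤ.* (d ℤ.* N) ℤ.* y)
    ≡⟨ cong (λ z → D ℤ.* d ℤ.* (N ℤ.* w) ℤ.+ D ℤ.* z) (sym diff) ⟩
  D ℤ.* d ℤ.* (N ℤ.* w) ℤ.+ D ℤ.* (x ℤ.- x′)
    ≡⟨ e₂ D d (N ℤ.* w) x x′ ⟩
  D ℤ.* d ℤ.* (N ℤ.* w) ℤ.+ D ℤ.* x ℤ.- D ℤ.* x′
    ≡⟨ cong₂ ℤ._-_ (cong₂ ℤ._+_ (cong (D ℤ.* d ℤ.*_) w-eq) x-eq) x′-eq ⟩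
  D ℤ.* d ℤ.* (A ℤ.+ a₀ ℤ.* v₀) ℤ.+ (P ℤ.- C ℤ.* v₀) ℤ.- (P′ ℤ.- C′ ℤ.* v₀)
    ≡⟨ e₃ (D ℤ.* d) A a₀ v₀ P P′ C C′ ⟩
  D ℤ.* d ℤ.* A ℤ.+ P ℤ.- P′ ℤ.+ (D ℤ.* d ℤ.* a₀ ℤ.+ C′ ℤ.- C) ℤ.* v₀ ∎
  where
  open ≡-Reasoning
  e₁ : ∀ D d N w l y → D ℤ.* d ℤ.* N ℤ.* (w ℤ.+ l ℤ.* y) ≡ D ℤ.* d ℤ.* (N ℤ.* w) ℤ.+ D ℤ.* (l ℤ.* (d ℤ.* N) ℤ.* y)
  e₁ = solve-∀
  e₂ : ∀ D d x p p′ → D ℤ.* d ℤ.* x ℤ.+ D ℤ.* (p ℤ.- p′) ≡ D ℤ.* d ℤ.* x ℤ.+ D ℤ.* p ℤ.- D ℤ.* p′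
  e₂ = solve-∀
  e₃ : ∀ K A a₀ v₀ P P′ C C′ → K ℤ.* (A ℤ.+ a₀ ℤ.* v₀) ℤ.+ (P ℤ.- C ℤ.* v₀) ℤ.- (P′ ℤ.- C′ ℤ.* v₀) ≡
    K ℤ.* A ℤ.+ P ℤ.- P′ ℤ.+ (K ℤ.* a₀ ℤ.+ C′ ℤ.- C) ℤ.* v₀
  e₃ = solve-∀

-- Blichfeldt's argument: the box with sides aᵢ/N around w spans |det|·∏ aᵢ lattice points (after
-- scaling by N); two of them congruent modulo l·d·N differ by dN times a vector of lℤᵈ
-- which keeps w inside the simplex.
module Blichfeldt {d′ l k a₀ D : ℕ} (l≥1 : 1 ≤ l) (p₀ : Point (suc d′)) (vs : Vec (Point (suc d′)) (suc d′))
  (card : HasCard (Il l (p₀ ∷ vs)) k)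
  (as : Vec ℕ (suc d′)) (a₀≥1 : 1 ≤ a₀) (a₀≥as : All (_≤ a₀) as)
  (w : Point (suc d′)) (w∈l : InLattice l w)
  (w≡ : sum (a₀ ∷ as) ·ᵥ w ≡ lin (map +_ (a₀ ∷ as)) (p₀ ∷ vs))
  (B : BoxPoints D (edgeMatrix (p₀ ∷ vs)) as) where

  d N M : ℕ
  d = suc d′
  N = sum (a₀ ∷ as)
  -- The box has sides `as j` in place of `as j / N`, hence the factor N. The factor d protects the
  -- base vertex, whose weight changes by a sum of d box coordinates.
  M = l * (d * N)

  open BoxPoints B

  instance
    N≢0 : ℕ.NonZero N
    N≢0 = ℕ.>-nonZero (ℕP.≤-trans a₀≥1 (ℕP.m≤m+n a₀ (sum as)))
    l≢0 : ℕ.NonZero l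
    l≢0 = ℕ.>-nonZero l≥1
    M≢0 : ℕ.NonZero M
    M≢0 = ℕP.m*n≢0 l (d * N) {{l≢0}} {{ℕP.m*n≢0 d N}}

  residue : Fin count → Fin d → Fin M
  residue i j = fromℕ< (ℤD.n%ℕd<d (lookup (point i) j) M)

  cls : Fin count → Fin (M ^ d)
  cls i = funToFin (residue i)

  cls-residue : ∀ {i i′} → cls i ≡ cls i′ → ∀ j → lookup (point i) j ℤD.%ℕ M ≡ lookup (point i′) j ℤD.%ℕ M
  cls-residue {i} {i′} eq j = trans (sym (FinP.toℕ-fromℕ< _)) (trans (cong toℕ
    (trans (sym (FinP.finToFun-funToFin (residue i) j)) (trans (cong (λ c → finToFun c j) eq)
      (FinP.finToFun-funToFin (residue i′) j)))) (FinP.toℕ-fromℕ< _))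

  quot : Fin count → Fin d → ℤ
  quot i j = lookup (point i) j ℤD./ℕ M

  shifted : Fin count → Fin count → Point d
  shifted i i′ = tabulate λ j → lookup w j ℤ.+ + l ℤ.* (quot i j ℤ.- quot i′ j)

  lookup-shifted : ∀ i i′ j → lookup (shifted i i′) j ≡ lookup w j ℤ.+ + l ℤ.* (quot i j ℤ.- quot i′ j)
  lookup-shifted i i′ j = lookup∘tabulate (λ j → lookup w j ℤ.+ + l ℤ.* (quot i j ℤ.- quot i′ j)) j

  shifted∈l : ∀ i i′ → InLattice l (shifted i i′)
  shifted∈l i i′ = AllP.tabulate⁺ {f = λ j → lookup w j ℤ.+ + l ℤ.* (quot i j ℤ.- quot i′ j)} λ j →
    ℤS.∣⇒∣ᵤ {+ l} (ℤS.∣m∣n⇒∣m+n {+ l} {lookup w j} (ℤS.∣ᵤ⇒∣ (AllP.lookup⁺ w∈l j))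
      (ℤS.divides (quot i j ℤ.- quot i′ j) (ℤP.*-comm (+ l) (quot i j ℤ.- quot i′ j))))

  as-lookup≤ : ∀ j → lookup as j ≤ a₀
  as-lookup≤ = AllP.lookup⁺ a₀≥as

  coord<K : ∀ i j → lookup (coord i) j ℕ.< D * d * lookup as j
  coord<K i j = ℕP.<-≤-trans (coord< i j) (ℕP.*-monoˡ-≤ (lookup as j) (ℕP.m≤m*n D d))

  -- Here the sorting pays off: each of the d coordinates is below `D * a₀` because `a₀` dominates
  -- `as`, so the base weight stays positive.
  sum-coord< : ∀ i → sum (coord i) ℕ.< D * d * a₀
  sum-coord< i = begin-strict
    sum (coord i)             <⟨ ℕP.m<m+n _ ℕ.z<s ⟩
    sum (coord i) + d       ≤⟨ sum-bound (coord i) (D * a₀) (λ j → ℕP.<-≤-trans (coord< i j) (ℕP.*-monoʳ-≤ D (as-lookup≤ j))) ⟩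
    d * (D * a₀)          ≡⟨ trans (sym (ℕP.*-assoc d D a₀)) (cong (_* a₀) (ℕP.*-comm d D)) ⟩
    D * d * a₀            ∎
    where open ℕP.≤-Reasoning

  point-difference : ∀ {i i′} → cls i ≡ cls i′ → ∀ j →
    lookup (point i) j ℤ.- lookup (point i′) j ≡ + M ℤ.* (quot i j ℤ.- quot i′ j)
  point-difference {i} {i′} eq j = trans (cong₂ ℤ._-_ (ℤD.a≡a%ℕn+[a/ℕn]*n (lookup (point i) j) M)
      (trans (ℤD.a≡a%ℕn+[a/ℕn]*n (lookup (point i′) j) M) (cong (λ r → + r ℤ.+ quot i′ j ℤ.* + M) (sym (cls-residue {i} {i′} eq j)))))
    (e (+ (lookup (point i) j ℤD.%ℕ M)) (quot i j) (quot i′ j) (+ M))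
    where
    e : ∀ r q q′ M → r ℤ.+ q ℤ.* M ℤ.- (r ℤ.+ q′ ℤ.* M) ≡ M ℤ.* (q ℤ.- q′)
    e = solve-∀

  shifted-interior : ∀ {i i′} → cls i ≡ cls i′ → InInterior (p₀ ∷ vs) (shifted i i′)
  shifted-interior {i} {i′} eq
    with shiftedWeights (D * d) as (coord i) (coord i′) (coord<K i′)
       | pos-difference {D * d * a₀ + sum (coord i′)} {sum (coord i)} (ℕP.<-≤-trans (sum-coord< i) (ℕP.m≤m+n _ _))
  ... | μ , μ≥1 , sum≡ , lin≡ | m , m≥1 , m≡ = m ∷ μ , m≥1 ∷ μ≥1 ,
    trans (lookup-ext coordinate) (sym (vsum-lin (m ∷ μ) (p₀ ∷ vs)))
    where
    K = D * d
    C C′ : ℤ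
    C = + sum (coord i)
    C′ = + sum (coord i′)
    m≡′ : + m ≡ + K ℤ.* + a₀ ℤ.+ C′ ℤ.- C
    m≡′ = trans m≡ (cong (ℤ._- C) (trans (ℤP.pos-+ (K * a₀) _) (cong (ℤ._+ C′) (ℤP.pos-* K a₀))))
    total≡ : + (m + sum μ) ≡ + D ℤ.* + d ℤ.* + N
    total≡ = trans (ℤP.pos-+ m (sum μ)) (trans (cong₂ ℤ._+_ m≡′ sum≡)
      (trans (e (+ K) (+ a₀) (+ sum as) C C′) (cong₂ ℤ._*_ (ℤP.pos-* D d) (sym (ℤP.pos-+ a₀ (sum as))))))
      where
      e : ∀ K a₀ A C C′ → K ℤ.* a₀ ℤ.+ C′ ℤ.- C ℤ.+ (K ℤ.* A ℤ.+ C ℤ.- C′) ≡ K ℤ.* (a₀ ℤ.+ A)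
      e = solve-∀
    coordinate : ∀ j → lookup ((m + sum μ) ·ᵥ shifted i i′) j ≡ lookup (lin (map +_ (m ∷ μ)) (p₀ ∷ vs)) j
    coordinate j = trans (lookup-map j _ (shifted i i′)) (trans (cong (+ (m + sum μ) ℤ.*_) (lookup-shifted i i′ j))
      (trans identity (sym (lookup-addMul (+ m) (lin (map +_ μ) vs) p₀ j))))
      where
      M≡ : + M ≡ + l ℤ.* (+ d ℤ.* + N)
      M≡ = trans (ℤP.pos-* l (d * N)) (cong (+ l ℤ.*_) (ℤP.pos-* d N))
      w-eq : + N ℤ.* lookup w j ≡ lookup (lin (map +_ as) vs) j ℤ.+ + a₀ ℤ.* lookup p₀ j
      w-eq = trans (sym (lookup-map j _ w)) (trans (cong (λ x → lookup x j) w≡)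
        (lookup-addMul (+ a₀) (lin (map +_ as) vs) p₀ j))
      point-eq : ∀ i → + D ℤ.* lookup (point i) j ≡
        lookup (lin (map +_ (coord i)) vs) j ℤ.- + sum (coord i) ℤ.* lookup p₀ j
      point-eq i = trans (sym (lookup-map j _ (point i))) (trans (cong (λ x → lookup x j) (point-lin i))
        (lookup-lin-edges (coord i) vs p₀ j))
      identity : + (m + sum μ) ℤ.* (lookup w j ℤ.+ + l ℤ.* (quot i j ℤ.- quot i′ j)) ≡
        lookup (lin (map +_ μ) vs) j ℤ.+ + m ℤ.* lookup p₀ j
      identity = barycentric-shift {+ (m + sum μ)} {+ D} {+ d} {+ N} {+ M} {+ l} {+ K} {+ a₀} {+ m}
        {lookup (lin (map +_ as) vs) j} {C} {C′} {lookup (lin (map +_ μ) vs) j}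
        {lookup (lin (map +_ (coord i)) vs) j} {lookup (lin (map +_ (coord i′)) vs) j}
        {lookup p₀ j} {lookup w j} {lookup (point i) j} {lookup (point i′) j} (quot i j ℤ.- quot i′ j)
        total≡ M≡ (ℤP.pos-* D d) w-eq (point-eq i) (point-eq i′) (point-difference {i} {i′} eq j) m≡′ (lin≡ vs j)

  -- The search ignores the given witness, which only excludes failure. The choice therefore depends
  -- on the class alone.
  representative : ∀ c → (∃ λ i → cls i ≡ c) → ∃ λ i → cls i ≡ c
  representative c p with FinP.any? (λ i → cls i Fin.≟ c)
  ... | yes q = q
  ... | no ¬p = ⊥-elim (¬p p)

  representative-const : ∀ c p q → proj₁ (representative c p) ≡ proj₁ (representative c q)
  representative-const c p q with FinP.any? (λ i → cls i Fin.≟ c)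
  ... | yes _ = refl
  ... | no ¬p = ⊥-elim (¬p p)

  rep : Fin count → Fin count
  rep i = proj₁ (representative (cls i) (i , refl))

  rep-cong : ∀ {i j} → cls i ≡ cls j → rep i ≡ rep j
  rep-cong {i} {j} eq = go (cls i) (cls j) eq _ _
    where
    go : ∀ c c′ → c ≡ c′ → ∀ p q → proj₁ (representative c p) ≡ proj₁ (representative c′ q)
    go c .c refl = representative-const c

  L : List.List (Point d)
  L = proj₁ card

  listed : ∀ i → ∃ λ t → shifted i (rep i) ≡ List.lookup L t
  listed i = Any.index x∈L , AnyP.lookup-index x∈L
    where
    x∈L : shifted i (rep i) ∈ L
    x∈L = Equivalence.from (proj₂ (proj₂ (proj₂ card)) _)
      (shifted-interior (sym (proj₂ (representative (cls i) (i , refl)))) , shifted∈l i (rep i))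

  same-quot : ∀ {i j} → rep i ≡ rep j → proj₁ (listed i) ≡ proj₁ (listed j) → ∀ c → quot i c ≡ quot j c
  same-quot {i} {j} same-rep same-index c =
    cancel-sub {x = quot (rep j) c} (ℤP.*-cancelˡ-≡ (+ l) (quot i c ℤ.- quot (rep j) c) (quot j c ℤ.- quot (rep j) c) {{l≢0}}
      (cancel-add {x = lookup w c} (trans (sym (lookup-shifted i (rep j) c))
        (trans (cong (λ x → lookup x c) same-point) (lookup-shifted j (rep j) c)))))
    where
    same-point : shifted i (rep j) ≡ shifted j (rep j)
    same-point = trans (cong (shifted i) (sym same-rep)) (trans (proj₂ (listed i))
      (trans (cong (List.lookup L) same-index) (sym (proj₂ (listed j)))))
    add-sub : ∀ a b → a ≡ a ℤ.- b ℤ.+ b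
    add-sub = solve-∀
    sub-add : ∀ a b → b ≡ a ℤ.+ b ℤ.- a
    sub-add = solve-∀
    cancel-sub : ∀ {a b x} → a ℤ.- x ≡ b ℤ.- x → a ≡ b
    cancel-sub {a} {b} {x} eq = trans (add-sub a x) (trans (cong (ℤ._+ x) eq) (sym (add-sub b x)))
    cancel-add : ∀ {a b x} → x ℤ.+ a ≡ x ℤ.+ b → a ≡ b
    cancel-add {a} {b} {x} eq = trans (sub-add x a) (trans (cong (ℤ._- x) eq) (sym (sub-add x b)))

  -- Members of one class are compared with the same representative, so the shifted point, and with
  -- it the index in the list, recovers the box point. Each of the `M ^ d` classes thus has at most
  -- k members.
  determined : ∀ {i j} → proj₁ (listed i) ≡ proj₁ (listed j) → cls i ≡ cls j → i ≡ j
  determined {i} {j} same-index same-cls = injective (lookup-ext λ c →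
    ℤP.i-j≡0⇒i≡j (lookup (point i) c) (lookup (point j) c)
      (trans (point-difference {i} {j} same-cls c) (trans (cong (λ q → + M ℤ.* q)
        (ℤP.i≡j⇒i-j≡0 (same-quot (rep-cong same-cls) same-index c))) (ℤP.*-zeroʳ (+ M)))))

  volume-bound : D * prod as ≤ k * M ^ d
  volume-bound = subst₂ _≤_ count≡ (cong (_* M ^ d) (proj₁ (proj₂ (proj₂ card)))) (jointly-injective⇒≤ (proj₁ ∘ listed) cls determined)

--

-- Moving to a more central lattice point

-- One colouring of the multipliers q per coordinate. Two multipliers that agree in all colours
-- yield the approximation q′ - q.
Colouring : Set
Colouring = Σ ℕ λ n → ℕ → Fin n

colours : ∀ {n} → Vec Colouring n → ℕ
colours cs = prod (map proj₁ cs)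

code : ∀ {n} (cs : Vec Colouring n) → ℕ → Fin (colours cs)
code []             q = zero
code ((_ , c) ∷ cs) q = combine (c q) (code cs q)

code-injective : ∀ {n} (cs : Vec Colouring n) {q q′} → code cs q ≡ code cs q′ →
  ∀ i → proj₂ (lookup cs i) q ≡ proj₂ (lookup cs i) q′
code-injective ((_ , c) ∷ cs) {q} {q′} eq i
  with FinP.combine-injective (c q) (code cs q) (c q′) (code cs q′) eq
code-injective (_ ∷ cs) eq zero    | eq₁ , eq₂ = eq₁
code-injective (_ ∷ cs) eq (suc i) | eq₁ , eq₂ = code-injective cs eq₂ i

colours≥1 : ∀ {n} (cs : Vec Colouring n) → 1 ≤ colours cs
colours≥1 cs = ℕP.≤-trans (ℕ.s≤s ℕ.z≤n) (FinP.toℕ<n (code cs 0))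

simultaneous : ∀ {n} (cs : Vec Colouring n) → ∃₂ λ q q′ → q ℕ.< q′ × q′ ≤ colours cs ×
  (∀ i → proj₂ (lookup cs i) q ≡ proj₂ (lookup cs i) q′)
simultaneous cs with FinP.pigeonhole (ℕP.n<1+n (colours cs)) (code cs ∘ toℕ)
... | i , j , i<j , eq = toℕ i , toℕ j , i<j , FinP.toℕ≤pred[n] j , code-injective cs eq

-- The approximation q′ - q of the coordinates aᵢ/N moves the numerator a by l·(u - t).
module Approximation (l d N a₀ m : ℕ) (l≥1 : 1 ≤ l) (d≥1 : 1 ≤ d) (m≥1 : 1 ≤ m)
  (a₀≥1 : 1 ≤ a₀) (a₀≤N : a₀ ≤ N) where

  -- If each of d weights moves by l·(u - t) with u - t ≤ a₀ / C, the base weight loses at most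
  -- d·l·a₀ / C = a₀ / 2. The further factor 2 in K absorbs the rounding in the number of cells: a +
  -- C·N ≤ K·N.
  C K : ℕ
  C = 2 * d * l
  K = 2 * C

  instance
    N≢0 : ℕ.NonZero N
    N≢0 = ℕ.>-nonZero (ℕP.≤-trans a₀≥1 a₀≤N)
    a₀≢0 : ℕ.NonZero a₀
    a₀≢0 = ℕ.>-nonZero a₀≥1
    d≢0 : ℕ.NonZero d
    d≢0 = ℕ.>-nonZero d≥1
    l≢0 : ℕ.NonZero l
    l≢0 = ℕ.>-nonZero l≥1
    C≢0 : ℕ.NonZero C
    C≢0 = ℕP.m*n≢0 (2 * d) l {{ℕP.m*n≢0 2 d}}
    K≢0 : ℕ.NonZero K
    K≢0 = ℕP.m*n≢0 2 C

  -- The integer x approximates (q′ - q)·a / N, and u - t is the error times N. The two bounds are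
  -- asymmetric: `upper` limits what the base weight must give up, `lower` keeps the new weight
  -- above m.
  record Step (a : ℕ) (q q′ : ℕ) : Set where
    constructor step
    field
      x     : ℤ
      u t   : ℕ
      upper : C * u ≤ a₀ + C * t
      lower : m + l * t ℕ.< a + l * u
      u-t   : + u ℤ.- + t ≡ (+ q′ ℤ.- + q) ℤ.* + a ℤ.- x ℤ.* + N

  Good : ℕ → ℕ → Colouring → Set
  Good Q a (_ , c) = ∀ {q q′} → q ℕ.< q′ → q′ ≤ Q → c q ≡ c q′ → Step a q q′

  trivial : Colouring
  trivial = 1 , λ _ → zero

  -- A weight beyond the gap is approximated by x = 0. It grows by l·(q′ - q)·a ≥ a ≥ m, while (q′ -
  -- q)·a ≤ Q·a ≤ a₀ / K.
  trivial-good : ∀ {Q a} → m ≤ a → K * Q * a ≤ a₀ → Good Q a trivial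
  trivial-good {Q} {a} m≤a small {q} {q′} q<q′ q′≤Q _ = step (+ 0) (k * a) 0 upper lower eq
    where
    open ℕP.≤-Reasoning
    k = q′ ∸ q
    upper : C * (k * a) ≤ a₀ + C * 0
    upper = begin
      C * (k * a)   ≤⟨ ℕP.*-monoʳ-≤ C (ℕP.*-monoˡ-≤ a (ℕP.≤-trans (ℕP.m∸n≤m q′ q) q′≤Q)) ⟩
      C * (Q * a)   ≡⟨ ℕP.*-assoc C Q a ⟨
      C * Q * a     ≤⟨ ℕP.*-monoˡ-≤ a (ℕP.*-monoˡ-≤ Q (ℕP.m≤n*m C 2)) ⟩
      K * Q * a     ≤⟨ small ⟩
      a₀                ≤⟨ ℕP.m≤m+n a₀ _ ⟩
      a₀ + C * 0    ∎
    lower : m + l * 0 ℕ.< a + l * (k * a)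
    lower = begin-strict
      m + l * 0             ≡⟨ trans (cong (m ℕ.+_) (ℕP.*-zeroʳ l)) (ℕP.+-identityʳ m) ⟩
      m                         <⟨ ℕP.m<m+n m m≥1 ⟩
      m + m                   ≤⟨ ℕP.+-mono-≤ m≤a (ℕP.≤-trans m≤a (ℕP.≤-trans
                                     (ℕP.m≤n*m a k {{ℕ.>-nonZero (ℕP.m<n⇒0<n∸m q<q′)}}) (ℕP.m≤n*m (k * a) l))) ⟩
      a + l * (k * a)     ∎
    e : ∀ k a N → k ℤ.* a ℤ.- + 0 ≡ k ℤ.* a ℤ.- + 0 ℤ.* N
    e = solve-∀
    eq : + (k * a) ℤ.- + 0 ≡ (+ q′ ℤ.- + q) ℤ.* + a ℤ.- + 0 ℤ.* + N
    eq = trans (cong (ℤ._- + 0) (trans (ℤP.pos-* k a) (cong (ℤ._* + a) (proj₂ (proj₂ (pos-difference q<q′))))))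
      (e (+ q′ ℤ.- + q) (+ a) (+ N))

  -- The residues of q·a modulo N are cut into cells of width a / C. Two multipliers in one cell
  -- change the weight a by less than l·a / C = a / (2d).
  module Fine (a : ℕ) .{{_ : ℕ.NonZero a}} where

    size : ℕ
    size = suc ((C * N) ℕ./ a)

    residue : ℕ → ℕ
    residue q = (q * a) ℕ.% N

    cell< : ∀ q → (C * residue q) ℕ./ a ℕ.< size
    cell< q = ℕ.s≤s (ℕD./-monoˡ-≤ a (ℕP.*-monoʳ-≤ C (ℕP.<⇒≤ (ℕD.m%n<n (q * a) N))))

    fine : Colouring
    fine = size , λ q → fromℕ< (cell< q)

    CN<size*a : C * N ℕ.< size * a
    CN<size*a = subst (ℕ._< size * a) (sym (ℕD.m≡m%n+[m/n]*n (C * N) a))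
      (ℕP.+-monoˡ-< _ (ℕD.m%n<n (C * N) a))

    size*a≤KN : a ≤ N → size * a ≤ K * N
    size*a≤KN a≤N = begin
      a + (C * N) ℕ./ a * a   ≤⟨ ℕP.+-mono-≤ a≤N (ℕD.m/n*n≤m (C * N) a) ⟩
      N + C * N                 ≤⟨ ℕP.+-monoˡ-≤ (C * N) (ℕP.m≤n*m N C) ⟩
      C * N + C * N           ≡⟨ e C N ⟩
      K * N                       ∎
      where
      open ℕP.≤-Reasoning
      e : ∀ C N → C * N + C * N ≡ 2 * C * N
      e = ℕSolver.solve-∀

    close : ∀ {r r′} → (C * r) ℕ./ a ≡ (C * r′) ℕ./ a → C * r ℕ.< a + C * r′
    close {r} {r′} eq = begin-strict
      C * r                                             ≡⟨ ℕD.m≡m%n+[m/n]*n (C * r) a ⟩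
      (C * r) ℕ.% a + (C * r) ℕ./ a * a           <⟨ ℕP.+-monoˡ-< _ (ℕD.m%n<n (C * r) a) ⟩
      a + (C * r) ℕ./ a * a                         ≡⟨ cong (λ z → a + z * a) eq ⟩
      a + (C * r′) ℕ./ a * a                        ≤⟨ ℕP.+-monoʳ-≤ a (ℕD.m/n*n≤m (C * r′) a) ⟩
      a + C * r′                                      ∎
      where open ℕP.≤-Reasoning

    fine-good : ∀ {Q} → a ≤ a₀ → size ≤ Q → K * Q * m ≤ a₀ → Good Q a fine
    fine-good {Q} a≤a₀ size≤Q small {q} {q′} q<q′ q′≤Q same =
      step (+ ((q′ * a) ℕ./ N) ℤ.- + ((q * a) ℕ./ N)) (residue q′) (residue q)
        (ℕP.≤-trans (ℕP.<⇒≤ (close (sym same-floor))) (ℕP.+-monoˡ-≤ _ a≤a₀)) lower eq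
      where
      open ℕP.≤-Reasoning
      same-floor : (C * residue q) ℕ./ a ≡ (C * residue q′) ℕ./ a
      same-floor = trans (sym (FinP.toℕ-fromℕ< (cell< q))) (trans (cong toℕ same) (FinP.toℕ-fromℕ< (cell< q′)))
      -- a₀ ≤ CN < size·a ≤ Q·a, so K·Q·m ≤ a₀ forces K·m ≤ a.
      Km≤a : K * m ≤ a
      Km≤a = ℕP.*-cancelʳ-≤ (K * m) a a₀ (begin
        K * m * a₀              ≤⟨ ℕP.*-monoʳ-≤ (K * m) (ℕP.≤-trans a₀≤N (ℕP.≤-trans (ℕP.m≤n*m N C)
                                         (ℕP.≤-trans (ℕP.<⇒≤ CN<size*a) (ℕP.*-monoˡ-≤ a size≤Q)))) ⟩
        K * m * (Q * a)       ≡⟨ e K m Q a ⟩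
        a * (K * Q * m)       ≤⟨ ℕP.*-monoʳ-≤ a small ⟩
        a * a₀                    ∎)
        where
        e : ∀ K m Q a → K * m * (Q * a) ≡ a * (K * Q * m)
        e = ℕSolver.solve-∀
      -- The decrease is below a / (2d) and m is at most a / (2d), so together they stay below a.
      lower : m + l * residue q ℕ.< a + l * residue q′
      lower = ℕP.*-cancelˡ-< (2 * d) _ _ (begin-strict
        2 * d * (m + l * residue q)                ≡⟨ e₁ d m l (residue q) ⟩
        2 * d * m + C * residue q                  <⟨ ℕP.+-monoʳ-< (2 * d * m) (close same-floor) ⟩
        2 * d * m + (a + C * residue q′)         ≤⟨ ℕP.+-monoˡ-≤ _ 2dm≤a ⟩
        a + (a + C * residue q′)                     ≡⟨ e₂ a (C * residue q′) ⟩
        2 * a + C * residue q′                       ≤⟨ ℕP.+-monoˡ-≤ _ (ℕP.*-monoˡ-≤ a (ℕP.m≤m*n 2 d)) ⟩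
        2 * d * a + C * residue q′                 ≡⟨ e₁ d a l (residue q′) ⟨
        2 * d * (a + l * residue q′)               ∎)
        where
        e₁ : ∀ d m l r → 2 * d * (m + l * r) ≡ 2 * d * m + 2 * d * l * r
        e₁ = ℕSolver.solve-∀
        e₂ : ∀ a r → a + (a + r) ≡ 2 * a + r
        e₂ = ℕSolver.solve-∀
        2dm≤a : 2 * d * m ≤ a
        2dm≤a = ℕP.≤-trans (ℕP.*-monoˡ-≤ m (ℕP.≤-trans (ℕP.m≤m*n (2 * d) l) (ℕP.m≤n*m C 2))) Km≤a
      e : ∀ r′ q′ r q N → r′ ℤ.- r ≡ (r′ ℤ.+ q′ ℤ.* N) ℤ.- (r ℤ.+ q ℤ.* N) ℤ.- (q′ ℤ.- q) ℤ.* N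
      e = solve-∀
      e′ : ∀ q′ q a → q′ ℤ.* a ℤ.- q ℤ.* a ≡ (q′ ℤ.- q) ℤ.* a
      e′ = solve-∀
      division : ∀ q → + residue q ℤ.+ + ((q * a) ℕ./ N) ℤ.* + N ≡ + q ℤ.* + a
      division q = trans (sym (trans (cong +_ (ℕD.m≡m%n+[m/n]*n (q * a) N)) (trans (ℤP.pos-+ (residue q) _)
        (cong (λ z → + residue q ℤ.+ z) (ℤP.pos-* ((q * a) ℕ./ N) N))))) (ℤP.pos-* q a)
      eq : + residue q′ ℤ.- + residue q ≡
        (+ q′ ℤ.- + q) ℤ.* + a ℤ.- (+ ((q′ * a) ℕ./ N) ℤ.- + ((q * a) ℕ./ N)) ℤ.* + N
      eq = trans (e (+ residue q′) (+ ((q′ * a) ℕ./ N)) (+ residue q) (+ ((q * a) ℕ./ N)) (+ N))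
        (cong (ℤ._- (+ ((q′ * a) ℕ./ N) ℤ.- + ((q * a) ℕ./ N)) ℤ.* + N)
          (trans (cong₂ ℤ._-_ (division q′) (division q)) (e′ (+ q′) (+ q) (+ a))))

-- When no gap occurs among the sorted numerators a₀ ≥ ⋯ ≥ aᵢ of the barycentric coordinates aⱼ/N,
-- then N^(i+1) ≤ loss d K i · a₀⋯aᵢ.
loss : (d K i : ℕ) → ℕ
loss d K zero    = suc d
loss d K (suc i) = loss d K i * loss d K i * K ^ suc i

power-* : ∀ x y i → (x * y) ^ i ≡ x ^ i * y ^ i
power-* x y zero    = refl
power-* x y (suc i) = trans (cong (x * y *_) (power-* x y i)) (e x y (x ^ i) (y ^ i))
  where
  e : ∀ x y a b → x * y * (a * b) ≡ x * a * (y * b)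
  e = ℕSolver.solve-∀

square-mono : ∀ {a b} → a ≤ b → a * a ≤ b * b
square-mono a≤b = ℕP.*-mono-≤ a≤b a≤b

module Move (l d N a₀ m : ℕ) (l≥1 : 1 ≤ l) (d≥1 : 1 ≤ d) (m≥1 : 1 ≤ m)
  (a₀≥1 : 1 ≤ a₀) (a₀≤N : a₀ ≤ N) where

  open Approximation l d N a₀ m l≥1 d≥1 m≥1 a₀≥1 a₀≤N
  X : ℕ → ℕ
  X = loss d K

  -- `Q` counts the colour combinations already spent on the weights before `as`, so
  -- `Q * colours cs` bounds the multiplier as a whole.
  Gap : ∀ {n} → ℕ → Vec ℕ n → Set
  Gap {n} Q as = ∃ λ (cs : Vec Colouring n) → K * (Q * colours cs) * m ≤ a₀ ×
    (∀ i → Good (Q * colours cs) (lookup as i) (lookup cs i))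

  Balanced : ℕ → ℕ → Set
  Balanced i P = N ^ suc i ≤ X i * (a₀ * P)

  colours-trivial : ∀ n → colours (replicate n trivial) ≡ 1
  colours-trivial zero    = refl
  colours-trivial (suc n) = trans (ℕP.+-identityʳ _) (colours-trivial n)

  trivial-gap : ∀ {n} {as : Vec ℕ (suc n)} Q a → K * Q * a ≤ a₀ → m ≤ a →
    All (m ≤_) as → All (_≤ a) as → Gap Q as
  trivial-gap {n} {as} Q a small m≤a m≤as as≤a = replicate (suc n) trivial ,
    subst (λ z → K * z * m ≤ a₀) (sym Q*1) (ℕP.≤-trans (ℕP.*-monoʳ-≤ (K * Q) m≤a) small) ,
    λ i → subst (λ c → Good (Q * colours (replicate (suc n) trivial)) (lookup as i) c) (sym (lookup-replicate i trivial))
      (trivial-good {Q * colours (replicate (suc n) trivial)} (AllP.lookup⁺ m≤as i)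
      (subst (λ z → K * z * lookup as i ≤ a₀) (sym Q*1)
        (ℕP.≤-trans (ℕP.*-monoʳ-≤ (K * Q) (AllP.lookup⁺ as≤a i)) small)))
    where
    Q*1 : Q * colours (replicate (suc n) trivial) ≡ Q
    Q*1 = trans (cong (Q *_) (colours-trivial (suc n))) (ℕP.*-identityʳ Q)

  -- Squaring the bound for R yields a second factor a₀·R. The missing gap a₀ ≤ K·Q·a and Q·R ≤
  -- (K·N)^i turn it into K·a·(K·N)^i, and N^i cancels. This is the origin of the recursion in
  -- `loss`.
  balanced-step : ∀ {i P Q R a} → Balanced i R → Q * R ≤ (K * N) ^ i → a₀ ≤ K * Q * a →
    P ≡ R * a → Balanced (suc i) P
  balanced-step {i} {_} {Q} {R} {a} balanced QR≤ no-gap refl =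
    ℕP.*-cancelˡ-≤ (N ^ i) {{ℕP.m^n≢0 N i}} (begin
      N ^ i * (N * (N * N ^ i))                     ≡⟨ e₁ N (N ^ i) ⟩
      N ^ suc i * N ^ suc i                             ≤⟨ square-mono balanced ⟩
      X i * p * (X i * p)                               ≡⟨ e₂ (X i) a₀ R p ⟩
      X i * X i * p * (a₀ * R)
        ≤⟨ ℕP.*-monoʳ-≤ (X i * X i * p) (ℕP.*-monoˡ-≤ R no-gap) ⟩
      X i * X i * p * (K * Q * a * R)            ≡⟨ e₃ (X i) p K Q a R ⟩
      X i * X i * p * (K * a) * (Q * R)           ≤⟨ ℕP.*-monoʳ-≤ (X i * X i * p * (K * a)) QR≤ ⟩
      X i * X i * p * (K * a) * (K * N) ^ i     ≡⟨ cong (X i * X i * p * (K * a) *_) (power-* K N i) ⟩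
      X i * X i * p * (K * a) * (K ^ i * N ^ i)
        ≡⟨ e₄ (X i) a₀ R K a (K ^ i) (N ^ i) ⟩
      N ^ i * (X (suc i) * (a₀ * (R * a)))          ∎)
    where
    open ℕP.≤-Reasoning
    p = a₀ * R
    e₁ : ∀ N n → n * (N * (N * n)) ≡ N * n * (N * n)
    e₁ = ℕSolver.solve-∀
    e₂ : ∀ X a₀ R p → X * p * (X * (a₀ * R)) ≡ X * X * p * (a₀ * R)
    e₂ = ℕSolver.solve-∀
    e₃ : ∀ X p K Q a R → X * X * p * (K * Q * a * R) ≡ X * X * p * (K * a) * (Q * R)
    e₃ = ℕSolver.solve-∀
    e₄ : ∀ X a₀ R K a k n → X * X * (a₀ * R) * (K * a) * (k * n) ≡
      n * (X * X * (K * k) * (a₀ * (R * a)))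
    e₄ = ℕSolver.solve-∀

  -- The scan has passed i weights with product R and cell counts with product Q; Q·R ≤ (K·N)^i
  -- because each `size * a` is at most K·N. The first weight with K·Q·a ≤ a₀ opens the gap: from
  -- there on colourings are trivial, before it they are fine.
  gap? : ∀ {n} (as : Vec ℕ n) i Q R → AllPairs ℕ._≥_ as → All (m ≤_) as → All (_≤ a₀) as → 1 ≤ Q →
    Q * R ≤ (K * N) ^ i → Balanced i R → Gap Q as ⊎ Balanced (i + n) (R * prod as)
  gap? [] i Q R _ _ _ _ _ balanced =
    inj₂ (subst₂ Balanced (sym (ℕP.+-identityʳ i)) (sym (ℕP.*-identityʳ R)) balanced)
  gap? {suc n} (a ∷ as) i Q R (a≥as ∷ sorted) (m≤a ∷ m≤as) (a≤a₀ ∷ as≤a₀) Q≥1 QR≤ balanced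
    with K * Q * a ℕ.≤? a₀
  ... | yes small = inj₁ (trivial-gap Q a small m≤a (m≤a ∷ m≤as) (ℕP.≤-refl ∷ a≥as))
  ... | no ¬small with gap? as (suc i) (Q * size) (R * a) sorted m≤as as≤a₀
          (ℕP.*-mono-≤ Q≥1 (ℕ.s≤s ℕ.z≤n)) QR≤′ (balanced-step {i} {Q = Q} balanced QR≤ (ℕP.<⇒≤ (ℕP.≰⇒> ¬small)) refl)
    where
    instance
      a≢0 : ℕ.NonZero a
      a≢0 = ℕ.>-nonZero (ℕP.≤-trans m≥1 m≤a)
    open Fine a
    open ℕP.≤-Reasoning
    e : ∀ Q s R a → Q * s * (R * a) ≡ s * a * (Q * R)
    e = ℕSolver.solve-∀
    QR≤′ : Q * size * (R * a) ≤ (K * N) ^ suc i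
    QR≤′ = begin
      Q * size * (R * a)   ≡⟨ e Q size R a ⟩
      size * a * (Q * R)   ≤⟨ ℕP.*-mono-≤ (size*a≤KN (ℕP.≤-trans a≤a₀ a₀≤N)) QR≤ ⟩
      (K * N) ^ suc i        ∎
  ...   | inj₂ balanced′ = inj₂ (subst₂ Balanced (sym (ℕP.+-suc i n)) (ℕP.*-assoc R a (prod as)) balanced′)
  -- Only now can `fine` be judged, since the range of the multiplier includes the colours chosen
  -- for later weights.
  ...   | inj₁ (cs , small , good) = inj₁ (fine ∷ cs , subst (λ z → K * z * m ≤ a₀) assoc small ,
            λ { zero → fine-good a≤a₀ size≤ (subst (λ z → K * z * m ≤ a₀) assoc small)
              ; (suc j) → subst (λ z → Good z (lookup as j) (lookup cs j)) assoc (good j) })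
    where
    instance
      a≢0 : ℕ.NonZero a
      a≢0 = ℕ.>-nonZero (ℕP.≤-trans m≥1 m≤a)
    open Fine a
    assoc : Q * size * colours cs ≡ Q * (size * colours cs)
    assoc = ℕP.*-assoc Q size (colours cs)
    size≤ : size ≤ Q * (size * colours cs)
    size≤ = ℕP.≤-trans (ℕP.m≤m*n size (colours cs) {{ℕ.>-nonZero (colours≥1 cs)}}) (ℕP.m≤n*m (size * colours cs) Q {{ℕ.>-nonZero Q≥1}})

  above-difference : ∀ {x y} → m + y ℕ.< x → ∃ λ k → m ℕ.< k × k + y ≡ x
  above-difference {x} {y} lt = x ∸ y , ℕP.m+n≤o⇒m≤o∸n (suc m) lt ,
    ℕP.m∸n+n≡m (ℕP.≤-trans (ℕP.m≤n+m y m) (ℕP.<⇒≤ lt))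

  -- The steps of all vertices but the base, summed up: they gain l·(U - T) in total, and s is the
  -- sum of the approximating integers.
  record NewWeights {n} (as : Vec ℕ n) (q : ℤ) : Set where
    field
      μ       : Vec ℕ n
      xs      : Vec ℤ n
      s       : ℤ
      U T     : ℕ
      m<μ     : All (m ℕ.<_) μ
      U-bound : C * U ≤ n * a₀ + C * T
      sum-μ   : sum μ + l * T ≡ sum as + l * U
      U-T     : + U ℤ.- + T ≡ q ℤ.* + sum as ℤ.- s ℤ.* + N
      lin-μ   : ∀ {D} (V : Vec (Point D) n) j → lookup (lin (map +_ μ) V) j ≡
        (+ 1 ℤ.+ + l ℤ.* q) ℤ.* lookup (lin (map +_ as) V) j ℤ.- + l ℤ.* + N ℤ.* lookup (lin xs V) j

  newWeights : ∀ {n} (as : Vec ℕ n) {q q′} → (∀ i → Step (lookup as i) q q′) → NewWeights as (+ q′ ℤ.- + q)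
  newWeights [] {q} {q′} _ = record
    { μ = [] ; xs = [] ; s = + 0 ; U = 0 ; T = 0 ; m<μ = []
    ; U-bound = ℕP.≤-refl ; sum-μ = refl ; U-T = e₁ (+ q′ ℤ.- + q) (+ N)
    ; lin-μ = λ { [] j → trans (lookup-replicate j (+ 0)) (trans (e₂ (+ 1 ℤ.+ + l ℤ.* (+ q′ ℤ.- + q)) (+ l ℤ.* + N))
        (cong (λ z → (+ 1 ℤ.+ + l ℤ.* (+ q′ ℤ.- + q)) ℤ.* z ℤ.- + l ℤ.* + N ℤ.* z) (sym (lookup-replicate j (+ 0))))) }
    }
    where
    e₁ : ∀ q N → + 0 ≡ q ℤ.* + 0 ℤ.- + 0 ℤ.* N
    e₁ = solve-∀
    e₂ : ∀ x y → + 0 ≡ x ℤ.* + 0 ℤ.- y ℤ.* + 0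
    e₂ = solve-∀
  newWeights {suc n} (a ∷ as) {q} {q′} steps with newWeights as (steps ∘ suc) | steps zero
  ... | W | step x u t upper lower u-t with above-difference lower
  ...   | k , m<k , k≡ = record
    { μ = k ∷ μ ; xs = x ∷ xs ; s = x ℤ.+ s ; U = u + U ; T = t + T ; m<μ = m<k ∷ m<μ
    ; U-bound = begin
        C * (u + U)                                        ≡⟨ ℕP.*-distribˡ-+ C u U ⟩
        C * u + C * U                                    ≤⟨ ℕP.+-mono-≤ upper U-bound ⟩
        (a₀ + C * t) + (n * a₀ + C * T)            ≡⟨ e₁ a₀ C t (n * a₀) T ⟩
        (a₀ + n * a₀) + C * (t + T)                  ∎
    ; sum-μ = trans (e₂ k (sum μ) l t T) (trans (cong₂ _+_ k≡ sum-μ) (sym (e₂ a (sum as) l u U)))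
    ; U-T = trans (cong₂ ℤ._-_ (ℤP.pos-+ u U) (ℤP.pos-+ t T)) (trans (e₃ (+ u) (+ U) (+ t) (+ T))
        (trans (cong₂ ℤ._+_ u-t U-T) (e₄ (+ q′ ℤ.- + q) (+ a) (+ sum as) x s (+ N))))
    ; lin-μ = lin-eq
    }
    where
    open NewWeights W
    open ℕP.≤-Reasoning
    q̂ = + q′ ℤ.- + q
    e₁ : ∀ a C t n T → (a + C * t) + (n + C * T) ≡ (a + n) + C * (t + T)
    e₁ = ℕSolver.solve-∀
    e₂ : ∀ a b l u v → a + b + l * (u + v) ≡ (a + l * u) + (b + l * v)
    e₂ = ℕSolver.solve-∀
    e₃ : ∀ a b c d → a ℤ.+ b ℤ.- (c ℤ.+ d) ≡ (a ℤ.- c) ℤ.+ (b ℤ.- d)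
    e₃ = solve-∀
    e₄ : ∀ q a A x s N → (q ℤ.* a ℤ.- x ℤ.* N) ℤ.+ (q ℤ.* A ℤ.- s ℤ.* N) ≡ q ℤ.* (a ℤ.+ A) ℤ.- (x ℤ.+ s) ℤ.* N
    e₄ = solve-∀
    e₅ : ∀ k l t → k ≡ k ℤ.+ l ℤ.* t ℤ.- l ℤ.* t
    e₅ = solve-∀
    e₆ : ∀ a l u t → a ℤ.+ l ℤ.* u ℤ.- l ℤ.* t ≡ a ℤ.+ l ℤ.* (u ℤ.- t)
    e₆ = solve-∀
    k≡′ : + k ≡ + a ℤ.+ + l ℤ.* (q̂ ℤ.* + a ℤ.- x ℤ.* + N)
    k≡′ = trans (e₅ (+ k) (+ l) (+ t)) (trans (cong (ℤ._- + l ℤ.* + t) pos) (trans (e₆ (+ a) (+ l) (+ u) (+ t))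
      (cong (λ z → + a ℤ.+ + l ℤ.* z) u-t)))
      where
      pos : + k ℤ.+ + l ℤ.* + t ≡ + a ℤ.+ + l ℤ.* + u
      pos = trans (cong (λ z → + k ℤ.+ z) (sym (ℤP.pos-* l t))) (trans (cong +_ k≡)
        (cong (λ z → + a ℤ.+ z) (ℤP.pos-* l u)))
    e₇ : ∀ q l N a x A L v → ((+ 1 ℤ.+ l ℤ.* q) ℤ.* A ℤ.- l ℤ.* N ℤ.* L) ℤ.+ (a ℤ.+ l ℤ.* (q ℤ.* a ℤ.- x ℤ.* N)) ℤ.* v ≡
      (+ 1 ℤ.+ l ℤ.* q) ℤ.* (A ℤ.+ a ℤ.* v) ℤ.- l ℤ.* N ℤ.* (L ℤ.+ x ℤ.* v)
    e₇ = solve-∀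
    lin-eq : ∀ {D} (V : Vec (Point D) (suc n)) j → lookup (lin (map +_ (k ∷ μ)) V) j ≡
        (+ 1 ℤ.+ + l ℤ.* q̂) ℤ.* lookup (lin (map +_ (a ∷ as)) V) j ℤ.- + l ℤ.* + N ℤ.* lookup (lin (x ∷ xs) V) j
    lin-eq (p ∷ V) j = trans (lookup-addMul (+ k) (lin (map +_ μ) V) p j)
      (trans (cong₂ (λ y z → y ℤ.+ z ℤ.* lookup p j) (lin-μ V j) k≡′)
      (trans (e₇ q̂ (+ l) (+ N) (+ a) x (lookup (lin (map +_ as) V) j) (lookup (lin xs V) j) (lookup p j))
      (sym (cong₂ (λ y z → (+ 1 ℤ.+ + l ℤ.* q̂) ℤ.* y ℤ.- + l ℤ.* + N ℤ.* z)
        (lookup-addMul (+ a) (lin (map +_ as) V) p j) (lookup-addMul x (lin xs V) p j)))))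

  -- Since C = 2dl, the base vertex gives up l·(U - T) ≤ a₀ / 2, and m < a₀ / 2 follows from 4·m ≤
  -- K·m ≤ a₀.
  apex-weight : ∀ {U T} → C * U ≤ d * a₀ + C * T → K * m ≤ a₀ → m + l * U ℕ.< a₀ + l * T
  apex-weight {U} {T} U-bound small = ℕP.*-cancelˡ-< 2 _ _ (begin-strict
    2 * (m + l * U)                       ≡⟨ ℕP.*-distribˡ-+ 2 m (l * U) ⟩
    2 * m + 2 * (l * U)                 ≤⟨ ℕP.+-monoʳ-≤ (2 * m) (ℕP.*-cancelˡ-≤ d (begin
      d * (2 * (l * U))                     ≡⟨ e₁ d l U ⟩
      C * U                                     ≤⟨ U-bound ⟩
      d * a₀ + C * T                        ≡⟨ e₂ d a₀ l T ⟩
      d * (a₀ + 2 * (l * T))              ∎)) ⟩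
    2 * m + (a₀ + 2 * (l * T))        <⟨ ℕP.+-monoˡ-< _ 2m<a₀ ⟩
    a₀ + (a₀ + 2 * (l * T))             ≡⟨ e₃ a₀ (l * T) ⟩
    2 * (a₀ + l * T)                      ∎)
    where
    open ℕP.≤-Reasoning
    e₁ : ∀ d l U → d * (2 * (l * U)) ≡ 2 * d * l * U
    e₁ = ℕSolver.solve-∀
    e₂ : ∀ d a l T → d * a + 2 * d * l * T ≡ d * (a + 2 * (l * T))
    e₂ = ℕSolver.solve-∀
    e₃ : ∀ a t → a + (a + 2 * t) ≡ 2 * (a + t)
    e₃ = ℕSolver.solve-∀
    2m<a₀ : 2 * m ℕ.< a₀
    2m<a₀ = begin-strict
      2 * m            <⟨ ℕP.m<m+n (2 * m) (ℕP.≤-trans m≥1 (ℕP.m≤n*m m 2)) ⟩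
      2 * m + 2 * m ≡⟨ e₄ m ⟩
      4 * m            ≤⟨ ℕP.*-monoˡ-≤ m (ℕP.*-monoʳ-≤ 2 (ℕP.≤-trans (ℕP.m≤m*n 2 d) (ℕP.m≤m*n (2 * d) l))) ⟩
      K * m            ≤⟨ small ⟩
      a₀                 ∎
      where
      e₄ : ∀ m → 2 * m + 2 * m ≡ 4 * m
      e₄ = ℕSolver.solve-∀

  record Improved (p₀ : Point d) (vs : Vec (Point d) d) : Set where
    field
      weights : Vec ℕ (suc d)
      m<      : All (m ℕ.<_) weights
      total   : sum weights ≡ N
      w       : Point d
      w∈l     : InLattice l w
      w≡      : sum weights ·ᵥ w ≡ lin (map +_ weights) (p₀ ∷ vs)

  improve : ∀ p₀ vs as → sum (a₀ ∷ as) ≡ N → ∀ w → InLattice l w →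
    sum (a₀ ∷ as) ·ᵥ w ≡ lin (map +_ (a₀ ∷ as)) (p₀ ∷ vs) → Gap 1 as → Improved p₀ vs
  improve p₀ vs as total w w∈l w≡ (cs , small , good) with simultaneous cs
  ... | q , q′ , q<q′ , q′≤Q , same = go (newWeights as (λ i → good i q<q′ (subst (q′ ≤_) (sym (ℕP.*-identityˡ _)) q′≤Q) (same i)))
    where
    Km≤a₀ : K * m ≤ a₀
    Km≤a₀ = ℕP.≤-trans (ℕP.*-monoˡ-≤ m (ℕP.m≤m*n K (1 * colours cs) {{ℕP.m*n≢0 1 (colours cs) {{_}} {{ℕ.>-nonZero (colours≥1 cs)}}}})) small
    q̂ : ℤ
    q̂ = + q′ ℤ.- + q
    go : NewWeights as q̂ → Improved p₀ vs
    go W with above-difference (apex-weight (NewWeights.U-bound W) Km≤a₀)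
    ... | k , m<k , k≡ = record
      { weights = k ∷ μ ; m< = m<k ∷ m<μ ; total = total′ ; w = w′ ; w∈l = w′∈l
      ; w≡ = trans (cong (_·ᵥ w′) total′) (lookup-ext coordinate) }
      where
      open NewWeights W
      total′ : k + sum μ ≡ N
      total′ = ℕP.+-cancelʳ-≡ (l * U + l * T) _ _ (trans (e k (sum μ) (l * U) (l * T))
        (trans (cong₂ _+_ k≡ sum-μ) (trans (e′ a₀ (sum as) (l * U) (l * T)) (cong (_+ (l * U + l * T)) total))))
        where
        e : ∀ k μ u t → k + μ + (u + t) ≡ k + u + (μ + t)
        e = ℕSolver.solve-∀
        e′ : ∀ a A u t → a + t + (A + u) ≡ a + A + (u + t)
        e′ = ℕSolver.solve-∀
      -- The base vertex takes the integer q̂ - s, so that all the integers add up to q̂ and the new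
      -- coordinates to 1 + l·q̂ - l·q̂ = 1.
      shift : Fin d → ℤ
      shift j = q̂ ℤ.* lookup w j ℤ.- lookup (lin xs vs) j ℤ.- (q̂ ℤ.- s) ℤ.* lookup p₀ j
      w′ : Point d
      w′ = tabulate λ j → lookup w j ℤ.+ + l ℤ.* shift j
      w′∈l : InLattice l w′
      w′∈l = AllP.tabulate⁺ {f = λ j → lookup w j ℤ.+ + l ℤ.* shift j} λ j →
        ℤS.∣⇒∣ᵤ {+ l} (ℤS.∣m∣n⇒∣m+n {+ l} {lookup w j} (ℤS.∣ᵤ⇒∣ (AllP.lookup⁺ w∈l j))
          (ℤS.divides (shift j) (ℤP.*-comm (+ l) (shift j))))
      k≡′ : + k ≡ + a₀ ℤ.- + l ℤ.* (q̂ ℤ.* + sum as ℤ.- s ℤ.* + N)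
      k≡′ = trans (e₅ (+ k) (+ l) (+ U)) (trans (cong (ℤ._- + l ℤ.* + U) pos) (trans (e₆ (+ a₀) (+ l) (+ U) (+ T))
        (cong (λ z → + a₀ ℤ.- + l ℤ.* z) U-T)))
        where
        e₅ : ∀ k l t → k ≡ k ℤ.+ l ℤ.* t ℤ.- l ℤ.* t
        e₅ = solve-∀
        e₆ : ∀ a l u t → a ℤ.+ l ℤ.* t ℤ.- l ℤ.* u ≡ a ℤ.- l ℤ.* (u ℤ.- t)
        e₆ = solve-∀
        pos : + k ℤ.+ + l ℤ.* + U ≡ + a₀ ℤ.+ + l ℤ.* + T
        pos = trans (cong (λ z → + k ℤ.+ z) (sym (ℤP.pos-* l U))) (trans (cong +_ k≡)
          (cong (λ z → + a₀ ℤ.+ z) (ℤP.pos-* l T)))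
      N≡ : + N ≡ + a₀ ℤ.+ + sum as
      N≡ = trans (cong +_ (sym total)) (ℤP.pos-+ a₀ (sum as))
      w-eq : ∀ j → + N ℤ.* lookup w j ≡ lookup (lin (map +_ as) vs) j ℤ.+ + a₀ ℤ.* lookup p₀ j
      w-eq j = trans (cong (λ n → + n ℤ.* lookup w j) (sym total)) (trans (sym (lookup-map j _ w))
        (trans (cong (λ x → lookup x j) w≡) (lookup-addMul (+ a₀) (lin (map +_ as) vs) p₀ j)))
      coordinate : ∀ j → lookup (N ·ᵥ w′) j ≡ lookup (lin (map +_ (k ∷ μ)) (p₀ ∷ vs)) j
      coordinate j = trans (lookup-map j _ w′) (trans (cong (+ N ℤ.*_) (lookup∘tabulate (λ j → lookup w j ℤ.+ + l ℤ.* shift j) j))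
        (trans (e₁ (+ N) (lookup w j) (+ l) q̂ (lookup (lin xs vs) j) s (lookup p₀ j))
        (trans (cong₂ (λ z n → (+ 1 ℤ.+ + l ℤ.* q̂) ℤ.* z ℤ.- + l ℤ.* + N ℤ.* lookup (lin xs vs) j ℤ.-
             + l ℤ.* (n ℤ.* q̂ ℤ.- s ℤ.* + N) ℤ.* lookup p₀ j) (w-eq j) N≡)
        (trans (e₂ (+ l) q̂ (lookup (lin (map +_ as) vs) j) (+ a₀) (lookup p₀ j) (lookup (lin xs vs) j) (+ N) (+ sum as) s)
        (sym (trans (lookup-addMul (+ k) (lin (map +_ μ) vs) p₀ j) (cong₂ (λ y z → y ℤ.+ z ℤ.* lookup p₀ j) (lin-μ vs j) k≡′)))))))
        where
        e₁ : ∀ N w l q L s v → N ℤ.* (w ℤ.+ l ℤ.* (q ℤ.* w ℤ.- L ℤ.- (q ℤ.- s) ℤ.* v)) ≡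
          (+ 1 ℤ.+ l ℤ.* q) ℤ.* (N ℤ.* w) ℤ.- l ℤ.* N ℤ.* L ℤ.- l ℤ.* (N ℤ.* q ℤ.- s ℤ.* N) ℤ.* v
        e₁ = solve-∀
        e₂ : ∀ l q A a v L N S s → (+ 1 ℤ.+ l ℤ.* q) ℤ.* (A ℤ.+ a ℤ.* v) ℤ.- l ℤ.* N ℤ.* L ℤ.- l ℤ.* ((a ℤ.+ S) ℤ.* q ℤ.- s ℤ.* N) ℤ.* v ≡
          ((+ 1 ℤ.+ l ℤ.* q) ℤ.* A ℤ.- l ℤ.* N ℤ.* L) ℤ.+ (a ℤ.- l ℤ.* (q ℤ.* S ℤ.- s ℤ.* N)) ℤ.* v
        e₂ = solve-∀

-- The volume bound

-- Weights and vertices are paired so that sorting by weight permutes both alike.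
Weighted : ℕ → Set
Weighted d = Vec (ℕ × Point d) (suc d)

weights : ∀ {d} → Weighted d → Vec ℕ (suc d)
weights = map proj₁

vertices : ∀ {d} → Weighted d → Vertices d
vertices = map proj₂

record Barycentric {d} (l k m N : ℕ) (w : Point d) (a : Vec ℕ (suc d)) (v : Vertices d) : Set where
  constructor barycentric
  field
    m≤    : All (m ≤_) a
    total : sum a ≡ N
    w≡    : sum a ·ᵥ w ≡ lin (map +_ a) v
    card  : HasCard (Il l v) k

swap-barycentric : ∀ {d l k m N w} {ps qs : Weighted d} → Swap ps qs →
  Barycentric l k m N w (weights ps) (vertices ps) → Barycentric l k m N w (weights qs) (vertices qs)
swap-barycentric {w = w} {ps} {qs} s (barycentric m≤ total w≡ card) = barycentric
  (swap-All (swap-map proj₁ s) m≤)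
  (trans (swap-sum (swap-map proj₁ s)) total)
  (trans (cong (_·ᵥ w) (swap-sum (swap-map proj₁ s))) (trans w≡
    (trans (sym (swap-lin (swap-map proj₂ s) (weights ps)))
      (cong (λ a → lin (map +_ a) (vertices qs)) (swapLike-map proj₂ proj₁ s)))))
  (swap-HasCard (swap-map proj₂ s) card)

swaps-barycentric : ∀ {d l k m N w} {ps qs : Weighted d} → Star Swap ps qs →
  Barycentric l k m N w (weights ps) (vertices ps) →
  Barycentric l k m N w (weights qs) (vertices qs) × normVol (vertices ps) ≡ normVol (vertices qs)
swaps-barycentric ε        b = b , refl
swaps-barycentric (s ◅ ss) b with swaps-barycentric ss (swap-barycentric s b)
... | b′ , eq = b′ , trans (sym (swap-normVol (swap-map proj₂ s))) eq

head≤sum : ∀ {n} {m} {a : Vec ℕ (suc n)} → All (m ≤_) a → m ≤ sum a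
head≤sum {a = a ∷ as} (m≤a ∷ _) = ℕP.≤-trans m≤a (ℕP.m≤m+n a (sum as))

sum-upper : ∀ {n} {b} {a : Vec ℕ n} → All (_≤ b) a → sum a ≤ n * b
sum-upper []          = ℕ.z≤n
sum-upper (a≤b ∷ as≤b) = ℕP.+-mono-≤ a≤b (sum-upper as≤b)

prod≥1 : ∀ {n} {a : Vec ℕ n} → All (1 ≤_) a → 1 ≤ prod a
prod≥1 []           = ℕP.≤-refl
prod≥1 (1≤a ∷ 1≤as) = ℕP.*-mono-≤ 1≤a (prod≥1 1≤as)

module Bound (d′ l k : ℕ) (l≥1 : 1 ≤ l) where

  d K : ℕ
  d = suc d′
  K = 2 * (2 * d * l)

  X : ℕ → ℕ
  X = loss d K

  bound : ℕ
  bound = k * (l ^ d * d ^ d * X d)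

  -- Multiplying the box inequality by a₀ ≤ N raises its power of N to d + 1, the one that the
  -- no-gap bound controls; then a₀·P cancels.
  volume-bound : ∀ {D N a₀ P} → 1 ≤ a₀ → 1 ≤ P → a₀ ≤ N → D * P ≤ k * (l * (d * N)) ^ d →
    N ^ suc d ≤ X d * (a₀ * P) → D ≤ bound
  volume-bound {D} {N} {a₀} {P} a₀≥1 P≥1 a₀≤N blichfeldt balanced =
    ℕP.*-cancelʳ-≤ D bound (a₀ * P) {{ℕ.>-nonZero (ℕP.*-mono-≤ a₀≥1 P≥1)}} (begin
      D * (a₀ * P)                          ≡⟨ e₁ D a₀ P ⟩
      D * P * a₀                            ≤⟨ ℕP.*-mono-≤ blichfeldt a₀≤N ⟩
      k * (l * (d * N)) ^ d * N             ≡⟨ cong (λ z → k * z * N) (trans (power-* l (d * N) d) (cong (l ^ d *_) (power-* d N d))) ⟩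
      k * (l ^ d * (d ^ d * N ^ d)) * N     ≡⟨ e₂ k (l ^ d) (d ^ d) (N ^ d) N ⟩
      k * (l ^ d * d ^ d) * N ^ suc d       ≤⟨ ℕP.*-monoʳ-≤ (k * (l ^ d * d ^ d)) balanced ⟩
      k * (l ^ d * d ^ d) * (X d * (a₀ * P)) ≡⟨ e₃ k (l ^ d * d ^ d) (X d) (a₀ * P) ⟩
      bound * (a₀ * P)                      ∎)
    where
    open ℕP.≤-Reasoning
    e₁ : ∀ D a P → D * (a * P) ≡ D * P * a
    e₁ = ℕSolver.solve-∀
    e₂ : ∀ k l d n N → k * (l * (d * n)) * N ≡ k * (l * d) * (N * n)
    e₂ = ℕSolver.solve-∀
    e₃ : ∀ k c X p → k * c * (X * p) ≡ k * (c * X) * p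
    e₃ = ℕSolver.solve-∀

  open Sort {ℕ × Point d} {λ p q → proj₁ q ≤ proj₁ p} (λ p q → ℕP.≤-total (proj₁ q) (proj₁ p)) (λ q≤p r≤q → ℕP.≤-trans r≤q q≤p)

  -- Each improvement raises the least weight m while the total weight N stays fixed.
  descent : ∀ fuel {m N} (w : Point d) a v → 1 ≤ m → N ℕ.< m + fuel → InLattice l w → Barycentric l k m N w a v → normVol v ≤ bound
  sorted-descent : ∀ fuel {m N} (w : Point d) a v → AllPairs ℕ._≥_ a → 1 ≤ m → N ℕ.< m + suc fuel → InLattice l w →
    Barycentric l k m N w a v → normVol v ≤ bound

  descent zero {m} {N} w a v m≥1 N<m w∈l b = ⊥-elim (ℕP.<⇒≱ N<m
    (subst₂ _≤_ (sym (ℕP.+-identityʳ m)) (Barycentric.total b) (head≤sum (Barycentric.m≤ b))))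
  descent (suc fuel) w a v m≥1 N<m w∈l b with sort (Vec.zip a v)
  ... | qs , ss , sorted with swaps-barycentric ss
          (subst₂ (Barycentric _ _ _ _ w) (sym (map-proj₁-zip a v)) (sym (map-proj₂-zip a v)) b)
  ...   | b′ , vol≡ = subst (_≤ bound) (trans (sym vol≡) (cong normVol (map-proj₂-zip a v)))
          (sorted-descent fuel w (weights qs) (vertices qs) (AllPairsP.map⁺ sorted) m≥1 N<m w∈l b′)

  sorted-descent fuel {m} {N} w (a₀ ∷ as) (p₀ ∷ vs) (a₀≥as ∷ sorted) m≥1 N<m w∈l (barycentric (m≤a₀ ∷ m≤as) total w≡ card) =
    decide (Move.gap? l d N a₀ m l≥1 d≥1 m≥1 a₀≥1 a₀≤N as 0 1 1 sorted m≤as a₀≥as ℕP.≤-refl ℕP.≤-refl initial)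
    where
    d≥1 : 1 ≤ d
    d≥1 = ℕ.s≤s ℕ.z≤n
    a₀≥1 : 1 ≤ a₀
    a₀≥1 = ℕP.≤-trans m≥1 m≤a₀
    as≥1 : All (1 ≤_) as
    as≥1 = All.map (ℕP.≤-trans m≥1) m≤as
    a₀≤N : a₀ ≤ N
    a₀≤N = subst (a₀ ≤_) total (ℕP.m≤m+n a₀ (sum as))
    -- The largest of d + 1 weights is at least their mean, whence the start value `suc d` of
    -- `loss`.
    initial : N ^ 1 ≤ suc d * (a₀ * 1)
    initial = subst₂ _≤_ (trans total (sym (ℕP.*-identityʳ N))) (cong (suc d *_) (sym (ℕP.*-identityʳ a₀)))
      (sum-upper (ℕP.≤-refl ∷ a₀≥as))
    decide : Move.Gap l d N a₀ m l≥1 d≥1 m≥1 a₀≥1 a₀≤N 1 as ⊎ N ^ suc d ≤ X d * (a₀ * (1 * prod as)) →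
      normVol (p₀ ∷ vs) ≤ bound
    decide (inj₂ balanced) = volume-bound a₀≥1 (prod≥1 as≥1) a₀≤N
      (subst (λ n → normVol (p₀ ∷ vs) * prod as ≤ k * (l * (d * n)) ^ d) total
        (Blichfeldt.volume-bound l≥1 p₀ vs card as a₀≥1 a₀≥as w w∈l w≡ (boxPoints (edgeMatrix (p₀ ∷ vs)) as)))
      (subst (λ P → N ^ suc d ≤ X d * (a₀ * P)) (ℕP.*-identityˡ (prod as)) balanced)
    decide (inj₁ gap) = descent fuel w′ weights′ (p₀ ∷ vs) (ℕP.m≤n⇒m≤1+n m≥1) (subst (N ℕ.<_) (ℕP.+-suc m fuel) N<m) w∈l′
      (barycentric m<′ total′ w≡′ card)
      where
      open Move.Improved (Move.improve l d N a₀ m l≥1 d≥1 m≥1 a₀≥1 a₀≤N p₀ vs as total w w∈l w≡ gap)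
        renaming (weights to weights′; m< to m<′; total to total′; w to w′; w∈l to w∈l′; w≡ to w≡′)

  -- A positive k supplies the interior point from which the descent starts, with least weight at
  -- least 1 and fuel above N.
  normVol-bound : 1 ≤ k → ∀ (v : Vertices d) → HasCard (Il l v) k → normVol v ≤ bound
  normVol-bound k≥1 v card@(List.[] , _ , len , _) = ⊥-elim (ℕP.n≮n 0 (subst (1 ≤_) (sym len) k≥1))
  normVol-bound k≥1 v card@(x List.∷ L , _ , _ , mem) with Equivalence.to (mem x) (Any.here refl)
  ... | (μ , μ≥1 , eq) , x∈l = descent (suc (sum μ)) x μ v ℕP.≤-refl (ℕP.m<n⇒m<1+n (ℕP.n<1+n (sum μ))) x∈l
          (barycentric μ≥1 refl (trans eq (vsum-lin μ v)) card)

-- Solving the recursion for the loss and comparing with the stated constant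

loss-solved : ∀ d K i → loss d K i * K ^ (2 + i) ≡ (suc d * (K * K)) ^ (2 ^ i)
loss-solved d K zero    = e d K
  where
  e : ∀ d K → (1 + d) * (K * (K * 1)) ≡ (1 + d) * (K * K) * 1
  e = ℕSolver.solve-∀
loss-solved d K (suc i) = begin
  -- The factor K^(2 + i) is chosen so that K^(i+1)·K^(i+3) is its square: the recursion becomes
  -- plain squaring.
  x * x * (K * K ^ i) * (K * (K * (K * K ^ i)))            ≡⟨ e x K (K ^ i) ⟩
  x * K ^ (2 + i) * (x * K ^ (2 + i))                      ≡⟨ cong₂ _*_ (loss-solved d K i) (loss-solved d K i) ⟩
  b ^ (2 ^ i) * b ^ (2 ^ i)                                ≡⟨ ℕP.^-distribˡ-+-* b (2 ^ i) (2 ^ i) ⟨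
  b ^ (2 ^ i + 2 ^ i)                                      ≡⟨ cong (λ z → b ^ (2 ^ i + z)) (ℕP.+-identityʳ (2 ^ i)) ⟨
  b ^ (2 ^ suc i)                                          ∎
  where
  open ≡-Reasoning
  x = loss d K i
  b = suc d * (K * K)
  e : ∀ x K k → x * x * (K * k) * (K * (K * (K * k))) ≡ x * (K * (K * k)) * (x * (K * (K * k)))
  e = ℕSolver.solve-∀

-- For d = 3 + e and K = 4dl this is (d+1)·K² ≤ (8l)^(2(d-1)) at l = 1.
cubic≤64^ : ∀ e → 16 * ((4 + e) * ((3 + e) * (3 + e))) ≤ 64 ^ (2 + e)
cubic≤64^ zero    = ℕP.≤ᵇ⇒≤ 576 4096 _
cubic≤64^ (suc e) = begin
  16 * ((5 + e) * ((4 + e) * (4 + e)))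
    -- The added term is what the left side lacks: 64·(3+e)² - (5+e)·(4+e) = 556 + 375·e + 63·e².
    ≤⟨ ℕP.m≤m+n _ (16 * (4 + e) * (556 + 375 * e + 63 * (e * e))) ⟩
  16 * ((5 + e) * ((4 + e) * (4 + e))) + 16 * (4 + e) * (556 + 375 * e + 63 * (e * e))
    ≡⟨ g e ⟩
  64 * (16 * ((4 + e) * ((3 + e) * (3 + e))))
    ≤⟨ ℕP.*-monoʳ-≤ 64 (cubic≤64^ e) ⟩
  64 ^ (3 + e) ∎
  where
  open ℕP.≤-Reasoning
  g : ∀ e → 16 * ((5 + e) * ((4 + e) * (4 + e))) + 16 * (4 + e) * (556 + 375 * e + 63 * (e * e)) ≡ 64 * (16 * ((4 + e) * ((3 + e) * (3 + e))))
  g = ℕSolver.solve-∀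

-- The estimate (d+1)·K² ≤ (8l+7)^(2(d-1)) would read 192·l² ≤ (8l+7)², false for l ≥ 2. The exact
-- loss 81·K⁴ with K = 8l uses only four of the eight factors 8l + 7; the other four and 2⁴ absorb
-- 324.
numeric-plane : ∀ l → 2 ^ 2 * loss 2 (2 * (2 * 2 * l)) 2 ≤ 2 ^ 4 * (8 * l + 7) ^ 8
numeric-plane l = begin
  2 ^ 2 * loss 2 (2 * (2 * 2 * l)) 2      ≡⟨ e l ⟩
  324 * (8 * l) ^ 4                         ≤⟨ ℕP.*-mono-≤ (ℕP.≤ᵇ⇒≤ 324 (2 ^ 4 * 7 ^ 4) _) (ℕP.^-monoˡ-≤ 4 (ℕP.m≤m+n (8 * l) 7)) ⟩
  2 ^ 4 * 7 ^ 4 * b ^ 4                     ≤⟨ ℕP.*-monoˡ-≤ (b ^ 4) (ℕP.*-monoʳ-≤ (2 ^ 4) (ℕP.^-monoˡ-≤ 4 (ℕP.m≤n+m 7 (8 * l)))) ⟩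
  2 ^ 4 * b ^ 4 * b ^ 4                     ≡⟨ trans (ℕP.*-assoc (2 ^ 4) (b ^ 4) (b ^ 4)) (cong (2 ^ 4 *_) (sym (ℕP.^-distribˡ-+-* b 4 4))) ⟩
  2 ^ 4 * b ^ 8                             ∎
  where
  open ℕP.≤-Reasoning
  b = 8 * l + 7
  x-plane : ∀ K → 2 ^ 2 * (3 * 3 * (K * 1) * (3 * 3 * (K * 1)) * (K * (K * 1))) ≡ 324 * (K * (K * (K * (K * 1))))
  x-plane = ℕSolver.solve-∀
  e : ∀ l → 2 ^ 2 * loss 2 (2 * (2 * 2 * l)) 2 ≡ 324 * (8 * l) ^ 4
  e l = trans (x-plane (2 * (2 * 2 * l))) (cong (λ K → 324 * K ^ 4) (K≡ l))
    where
    K≡ : ∀ l → 2 * (2 * 2 * l) ≡ 8 * l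
    K≡ = ℕSolver.solve-∀

numeric-base : ∀ e l → 1 ≤ l → let K = 2 * (2 * (3 + e) * l) in
  (4 + e) * (K * K) ≤ (8 * l + 7) ^ (2 * (2 + e))
numeric-base e l l≥1 = begin
  (4 + e) * (K * K)                                        ≡⟨ e₁ e l ⟩
  16 * ((4 + e) * ((3 + e) * (3 + e))) * l ^ 2             ≤⟨ ℕP.*-mono-≤ (cubic≤64^ e) (ℕP.^-monoʳ-≤ l {{ℕ.>-nonZero l≥1}} (ℕP.m≤m*n 2 (2 + e))) ⟩
  64 ^ (2 + e) * l ^ (2 * (2 + e))                         ≡⟨ cong (_* l ^ (2 * (2 + e))) (ℕP.^-*-assoc 8 2 (2 + e)) ⟩
  8 ^ (2 * (2 + e)) * l ^ (2 * (2 + e))                    ≡⟨ power-* 8 l (2 * (2 + e)) ⟨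
  (8 * l) ^ (2 * (2 + e))                                  ≤⟨ ℕP.^-monoˡ-≤ (2 * (2 + e)) (ℕP.m≤m+n (8 * l) 7) ⟩
  (8 * l + 7) ^ (2 * (2 + e))                              ∎
  where
  open ℕP.≤-Reasoning
  K = 2 * (2 * (3 + e) * l)
  e₁ : ∀ e l → (4 + e) * (2 * (2 * (3 + e) * l) * (2 * (2 * (3 + e) * l))) ≡ 16 * ((4 + e) * ((3 + e) * (3 + e))) * (l * (l * 1))
  e₁ = ℕSolver.solve-∀

-- The factor d^d from the box argument is at most K^(d+2), just what completes the loss to
-- ((d+1)·K²)^(2^d). The base is at most (8l+7)^(2(d-1)), which gives the exponent.
numeric-space : ∀ e l → 1 ≤ l → let d = 3 + e in
  d ^ d * loss d (2 * (2 * d * l)) d ≤ (8 * l + 7) ^ ((2 + e) * 2 ^ (d + 1))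
numeric-space e l l≥1 = begin
  d ^ d * x                          ≤⟨ ℕP.*-monoˡ-≤ x (ℕP.^-monoˡ-≤ d d≤K) ⟩
  K ^ d * x                          ≤⟨ ℕP.*-monoˡ-≤ x (ℕP.^-monoʳ-≤ K {{K≢0}} (ℕP.m≤n+m d 2)) ⟩
  K ^ (2 + d) * x                    ≡⟨ ℕP.*-comm (K ^ (2 + d)) x ⟩
  x * K ^ (2 + d)                    ≡⟨ loss-solved d K d ⟩
  (suc d * (K * K)) ^ (2 ^ d)        ≤⟨ ℕP.^-monoˡ-≤ (2 ^ d) (numeric-base e l l≥1) ⟩
  (b ^ (2 * (2 + e))) ^ (2 ^ d)      ≡⟨ ℕP.^-*-assoc b (2 * (2 + e)) (2 ^ d) ⟩
  b ^ (2 * (2 + e) * 2 ^ d)          ≡⟨ cong (b ^_) (trans (e₁ (2 + e) (2 ^ d)) (cong (λ n → (2 + e) * 2 ^ n) (ℕP.+-comm 1 d))) ⟩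
  b ^ ((2 + e) * 2 ^ (d + 1))        ∎
  where
  open ℕP.≤-Reasoning
  d K b x : ℕ
  d = 3 + e
  K = 2 * (2 * d * l)
  b = 8 * l + 7
  x = loss d K d
  d≤K : d ≤ K
  d≤K = ℕP.≤-trans (ℕP.m≤n*m d 2) (ℕP.≤-trans (ℕP.m≤m*n (2 * d) l {{ℕ.>-nonZero l≥1}}) (ℕP.m≤n*m (2 * d * l) 2))
  K≢0 : ℕ.NonZero K
  K≢0 = ℕ.>-nonZero (ℕP.≤-trans (ℕ.s≤s ℕ.z≤n) d≤K)
  e₁ : ∀ m p → 2 * m * p ≡ m * (2 * p)
  e₁ = ℕSolver.solve-∀

-- Dimension one: counting multiples of l

module Segment (l k : ℕ) (l≥1 : 1 ≤ l) (k≥1 : 1 ≤ k) (p : ℤ) (D : ℕ) where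

  v : Vertices 1
  v = (p ∷ []) ∷ (p ℤ.+ + D ∷ []) ∷ []

  instance
    l≢0 : ℕ.NonZero l
    l≢0 = ℕ.>-nonZero l≥1

  r : ℕ
  r = p ℤD.%ℕ l

  multiple : ℕ → ℤ
  multiple i = + l ℤ.* (p ℤD./ℕ l ℤ.+ + suc i)

  -- Distance of the i-th multiple of l after p from p.
  gap : ℕ → ℕ
  gap i = (l ∸ r) + l * i

  gap≥1 : ∀ i → 1 ≤ gap i
  gap≥1 i = ℕP.≤-trans (ℕP.m<n⇒0<n∸m (ℤD.n%ℕd<d p l)) (ℕP.m≤m+n (l ∸ r) (l * i))

  multiple≡ : ∀ i → multiple i ≡ p ℤ.+ + gap i
  multiple≡ i = sym (trans (cong₂ ℤ._+_ (ℤD.a≡a%ℕn+[a/ℕn]*n p l) (trans (ℤP.pos-+ (l ∸ r) (l * i))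
    (cong₂ ℤ._+_ (proj₂ (proj₂ (pos-difference (ℤD.n%ℕd<d p l)))) (ℤP.pos-* l i))))
    (trans (e (+ r) (p ℤD./ℕ l) (+ l) (+ i)) (cong (λ z → + l ℤ.* (p ℤD./ℕ l ℤ.+ z)) (sym (ℤP.pos-+ 1 i)))))
    where
    e : ∀ r q l i → r ℤ.+ q ℤ.* l ℤ.+ (l ℤ.- r ℤ.+ l ℤ.* i) ≡ l ℤ.* (q ℤ.+ (+ 1 ℤ.+ i))
    e = solve-∀

  interior : ∀ i → gap i ℕ.< D → Il l v (multiple i ∷ [])
  interior i gap<D with pos-difference gap<D
  ... | g , g≥1 , g≡ = (g ∷ gap i ∷ [] , g≥1 ∷ gap≥1 i ∷ [] , cong (_∷ []) eq) ,
        ℤS.∣⇒∣ᵤ {+ l} (ℤS.divides (p ℤD./ℕ l ℤ.+ + suc i) (ℤP.*-comm (+ l) _)) ∷ []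
    where
    e : ∀ D g p → (D ℤ.- g ℤ.+ (g ℤ.+ + 0)) ℤ.* (p ℤ.+ g) ≡ (D ℤ.- g) ℤ.* p ℤ.+ (g ℤ.* (p ℤ.+ D) ℤ.+ + 0)
    e = solve-∀
    eq : + (g + (gap i + 0)) ℤ.* multiple i ≡ + g ℤ.* p ℤ.+ (+ gap i ℤ.* (p ℤ.+ + D) ℤ.+ + 0)
    eq = trans (cong₂ ℤ._*_ (trans (ℤP.pos-+ g (gap i + 0)) (cong₂ ℤ._+_ g≡ (ℤP.pos-+ (gap i) 0))) (multiple≡ i))
      (trans (e (+ D) (+ gap i) p) (cong (λ z → z ℤ.* p ℤ.+ (+ gap i ℤ.* (p ℤ.+ + D) ℤ.+ + 0)) (sym g≡)))

  -- The first k + 1 multiples of l after p lie within l + l·k ≤ 2·l·k of p, so a longer segment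
  -- would have more than k of them inside.
  length-bound : HasCard (Il l v) k → D ≤ 2 * l * k
  length-bound (L , _ , len , mem) = ℕP.≮⇒≥ λ 2lk<D → ℕP.n≮n k (subst (suc k ≤_) len
    (FinP.injective⇒≤ {f = λ i → Any.index (listed 2lk<D i)} (injective 2lk<D)))
    where
    gap< : 2 * l * k ℕ.< D → ∀ (i : Fin (suc k)) → gap (toℕ i) ℕ.< D
    gap< 2lk<D i = ℕP.≤-<-trans (begin
      (l ∸ r) + l * toℕ i   ≤⟨ ℕP.+-mono-≤ (ℕP.m∸n≤m l r) (ℕP.*-monoʳ-≤ l (FinP.toℕ≤pred[n] i)) ⟩
      l + l * k             ≤⟨ ℕP.+-monoˡ-≤ (l * k) (ℕP.m≤m*n l k {{ℕ.>-nonZero k≥1}}) ⟩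
      l * k + l * k         ≡⟨ e l k ⟩
      2 * l * k             ∎) 2lk<D
      where
      open ℕP.≤-Reasoning
      e : ∀ l k → l * k + l * k ≡ 2 * l * k
      e = ℕSolver.solve-∀
    listed : 2 * l * k ℕ.< D → ∀ (i : Fin (suc k)) → (multiple (toℕ i) ∷ []) ∈ L
    listed 2lk<D i = Equivalence.from (mem _) (interior (toℕ i) (gap< 2lk<D i))
    cancel : ∀ {x a b} → x ℤ.+ a ≡ x ℤ.+ b → a ≡ b
    cancel {x} {a} {b} eq = trans (e x a) (trans (cong (ℤ._- x) eq) (sym (e x b)))
      where
      e : ∀ x b → b ≡ x ℤ.+ b ℤ.- x
      e = solve-∀
    injective : ∀ lt {i j} → Any.index (listed lt i) ≡ Any.index (listed lt j) → i ≡ j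
    injective lt {i} {j} eq = FinP.toℕ-injective (ℕP.suc-injective (ℤP.+-injective (cancel {p ℤD./ℕ l}
      (ℤP.*-cancelˡ-≡ (+ l) _ _ (cong Vec.head (trans (AnyP.lookup-index (listed lt i))
        (trans (cong (List.lookup L) eq) (sym (AnyP.lookup-index (listed lt j))))))))))

normVol-segment : ∀ p q → normVol ((p ∷ []) ∷ (q ∷ []) ∷ []) ≡ ∣ q ℤ.- p ∣
normVol-segment p q = cong ∣_∣ (e (q ℤ.- p))
  where
  e : ∀ x → + 1 ℤ.* x ℤ.* + 1 ℤ.+ + 0 ≡ x
  e = solve-∀

ordered-segment : ∀ l k → 1 ≤ l → 1 ≤ k → ∀ {p q} → p ℤ.≤ q → HasCard (Il l ((p ∷ []) ∷ (q ∷ []) ∷ [])) k →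
  normVol ((p ∷ []) ∷ (q ∷ []) ∷ []) ≤ 2 * l * k
ordered-segment l k l≥1 k≥1 {p} {q} p≤q card = subst (_≤ 2 * l * k) (sym (normVol-segment p q))
  (Segment.length-bound l k l≥1 k≥1 p ∣ q ℤ.- p ∣ (subst (λ z → HasCard (Il l ((p ∷ []) ∷ (z ∷ []) ∷ [])) k) q≡ card))
  where
  e : ∀ p q → q ≡ p ℤ.+ (q ℤ.- p)
  e = solve-∀
  q≡ : q ≡ p ℤ.+ + ∣ q ℤ.- p ∣
  q≡ = trans (e p q) (cong (λ z → p ℤ.+ z) (sym (ℤP.0≤i⇒+∣i∣≡i (ℤP.i≤j⇒0≤j-i p≤q))))

segment : ∀ l k → 1 ≤ l → 1 ≤ k → (v : Vertices 1) → HasCard (Il l v) k → normVol v ≤ 2 * l * k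
segment l k l≥1 k≥1 ((p ∷ []) ∷ (q ∷ []) ∷ []) card with ℤP.≤-total p q
... | inj₁ p≤q = ordered-segment l k l≥1 k≥1 p≤q card
... | inj₂ q≤p = subst (_≤ 2 * l * k) (swap-normVol {v = (p ∷ []) ∷ (q ∷ []) ∷ []} here)
      (ordered-segment l k l≥1 k≥1 q≤p (swap-HasCard here card))

theorem6 : (d k l : ℕ) → 1 ≤ d → 1 ≤ k → 1 ≤ l →
    (v : Vertices d) → IsSimplex v → HasCard (Il l v) k →
    normVol v ≤ 2 ^ (3 * d ∸ 2) * l ^ d * (8 * l + 7) ^ ((d ∸ 1) * 2 ^ (d + 1)) * k
theorem6 (suc zero) k l _ k≥1 l≥1 v _ card = subst (λ z → normVol v ≤ z * k) (e l) (segment l k l≥1 k≥1 v card)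
  where
  e : ∀ l → 2 * l ≡ 2 * (l * 1) * 1
  e = ℕSolver.solve-∀
theorem6 (suc (suc zero)) k l _ k≥1 l≥1 v _ card = begin
  normVol v                                                   ≤⟨ Bound.normVol-bound 1 l k l≥1 k≥1 v card ⟩
  k * (l ^ 2 * 2 ^ 2 * loss 2 (2 * (2 * 2 * l)) 2)          ≡⟨ cong (k *_) (ℕP.*-assoc (l ^ 2) (2 ^ 2) _) ⟩
  k * (l ^ 2 * (2 ^ 2 * loss 2 (2 * (2 * 2 * l)) 2))        ≤⟨ ℕP.*-monoʳ-≤ k (ℕP.*-monoʳ-≤ (l ^ 2) (numeric-plane l)) ⟩
  k * (l ^ 2 * (2 ^ 4 * (8 * l + 7) ^ 8))                     ≡⟨ rearrange k (l ^ 2) (2 ^ 4) ((8 * l + 7) ^ 8) ⟩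
  2 ^ 4 * l ^ 2 * (8 * l + 7) ^ 8 * k                         ∎
  where
  open ℕP.≤-Reasoning
  rearrange : ∀ k x t y → k * (x * (t * y)) ≡ t * x * y * k
  rearrange = ℕSolver.solve-∀
theorem6 (suc (suc (suc e))) k l _ k≥1 l≥1 v _ card = begin
  normVol v                                       ≤⟨ Bound.normVol-bound (2 + e) l k l≥1 k≥1 v card ⟩
  k * (l ^ d * d ^ d * x)                         ≡⟨ cong (k *_) (ℕP.*-assoc (l ^ d) (d ^ d) x) ⟩
  k * (l ^ d * (d ^ d * x))                       ≤⟨ ℕP.*-monoʳ-≤ k (ℕP.*-monoʳ-≤ (l ^ d) (numeric-space e l l≥1)) ⟩
  k * (l ^ d * y)                                 ≤⟨ ℕP.*-monoʳ-≤ k (ℕP.*-monoʳ-≤ (l ^ d) (ℕP.m≤n*m y (2 ^ (3 * d ∸ 2)) {{ℕP.m^n≢0 2 (3 * d ∸ 2)}})) ⟩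
  k * (l ^ d * (2 ^ (3 * d ∸ 2) * y))             ≡⟨ rearrange k (l ^ d) (2 ^ (3 * d ∸ 2)) y ⟩
  2 ^ (3 * d ∸ 2) * l ^ d * y * k                 ∎
  where
  open ℕP.≤-Reasoning
  d x y : ℕ
  d = 3 + e
  x = loss d (2 * (2 * d * l)) d
  y = (8 * l + 7) ^ ((2 + e) * 2 ^ (d + 1))
  rearrange : ∀ k x t y → k * (x * (t * y)) ≡ t * x * y * k
  rearrange = ℕSolver.solve-∀
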